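{- The logic $QFDE$ is sound and complete with respect to the class of all $QFDE$-structures: for every signature $\mathcal{S}$ and every $\Gamma\cup\{A\}\subseteq Sent(\mathcal{S})$, $\Gamma\vdash_{QFDE}A$ if and only if, for every $\mathcal{S}$-structure $\mathfrak{A}$, if $v_{\mathfrak{A}}(B)=1$ for every $B\in\Gamma$, then $v_{\mathfrak{A}}(A)=1$.
   Context: **Language of $QFDE$.** A signature is a pair $\mathcal{S}=\langle\mathcal{C},\mathcal{P}\rangle$, where $\mathcal{C}$ is an infinite set of individual constants and $\mathcal{P}$ is a set of predicate letters, each of finite arity, containing a binary identity predicate $\approx$. The logical symbols are $\neg$, $\land,\lor$, $\forall,\exists$, and variables $\mathcal{V}=\{v_i:i\in\mathbb{N}\}$. Terms are variables and constants (no function symbols). Formulas are defined as usual, except that void quantifiers are not allowed: $\forall xB$ and $\exists xB$ are formulas only if $x$ is free in $B$. $Form(\mathcal{S})$ and $Sent(\mathcal{S})$ are the sets of formulas and of sentences (closed formulas). $A(t/x)$ is the result of replacing every free occurrence of $x$ in $A$ by $t$. **Natural deduction system $QFDE$** (over sentences of $\mathcal{S}$; $c,c_1,c_2\in\mathcal{C}$; wherever $A(c/x)$ occurs, $A$ is a formula with no free variable other than $x$; square brackets mark discharged hypotheses): - $\land I$: from $A$, $B$ infer $A\land B$. $\land E$: from $A\land B$ infer $A$; from $A\land B$ infer $B$. - $\lor I$: from $A$ infer $A\lor B$; from $B$ infer $A\lor B$. $\lor E$: from $A\lor B$, a derivation of $C$ from $[A]$ and a derivation of $C$ from $[B]$,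 infer $C$. - $\neg\land I$: from $\neg A$ infer $\neg(A\land B)$; from $\neg B$ infer $\neg(A\land B)$. $\neg\land E$: from $\neg(A\land B)$, a derivation of $C$ from $[\neg A]$ and a derivation of $C$ from $[\neg B]$, infer $C$. - $\neg\lor I$: from $\neg A$, $\neg B$ infer $\neg(A\lor B)$. $\neg\lor E$: from $\neg(A\lor B)$ infer $\neg A$; from $\neg(A\lor B)$ infer $\neg B$. - $DN$: from $A$ infer $\neg\neg A$; from $\neg\neg A$ infer $A$. - $\forall I$: from $B\lor A(c/x)$ infer $B\lor\forall xA$, provided $c$ occurs neither in $A$ or $B$ nor in any hypothesis on which $B\lor A(c/x)$ depends. $\forall E$: from $\forall xA$ infer $A(c/x)$. - $\exists I$: from $A(c/x)$ infer $\exists xA$. $\exists E$: from $\exists xA$ and a derivation of $C$ from $[A(c/x)]$ infer $C$, provided $c$ occurs neither in $A$ or $C$ nor in any hypothesis on which $C$ depends, except $A(c/x)$. - $\neg\forall I$: from $\neg A(c/x)$ infer $\neg\forall xA$. $\neg\forall E$: from $\neg\forall xA$ and a derivation of $C$ from $[\neg A(c/x)]$ infer $C$, provided $c$ occurs neither in $A$ or $C$ nor in any hypothesis on which $C$ depends, except $\neg A(c/x)$. - $\neg\exists I$: from $\neg A(c/x)$ infer $\neg\exists xA$, provided $c$ occurs neither in $A$ nor in any hypothesis on which $\neg A(c/x)$ depends. $\neg\exists E$: from $\neg\exists xA$ infer $\neg A(c/x)$. - $\approx I$: infer $c\approx c$ from no premises. $\approx E$: from $c_1\approx c_2$ and $A(c_1/x)$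 infer $A(c_2/x)$. $\Gamma\vdash_{QFDE}A$ means there is a (finite, tree-shaped) derivation of $A$ all of whose undischarged hypotheses belong to $\Gamma$. **Semantics.** An $\mathcal{S}$-structure ($QFDE$-structure) is a pair $\mathfrak{A}=\langle\mathcal{D},\mathcal{I}\rangle$ with $\mathcal{D}\neq\emptyset$ such that $\mathcal{I}(c)=c^{\mathfrak{A}}\in\mathcal{D}$ for each $c\in\mathcal{C}$; each $n$-ary $P\in\mathcal{P}$ is assigned a pair $\langle P_+^{\mathfrak{A}},P_-^{\mathfrak{A}}\rangle$ with $P_+^{\mathfrak{A}}\cup P_-^{\mathfrak{A}}\subseteq\mathcal{D}^n$; and $\approx_+^{\mathfrak{A}}=\{\langle a,a\rangle:a\in\mathcal{D}\}$ (no constraint on $\approx_-^{\mathfrak A}$). The diagram signature $\mathcal{S}_{\mathfrak{A}}=\langle\mathcal{C}_{\mathfrak{A}},\mathcal{P}\rangle$ adds a new constant $\overline{a}$ for each $a\in\mathcal{D}$; $\widehat{\mathfrak{A}}$ is the $\mathcal{S}_{\mathfrak{A}}$-structure that is just like $\mathfrak{A}$ except that $\overline{a}^{\widehat{\mathfrak{A}}}=a$. The valuation induced by $\mathfrak{A}$ is the (unique) map $v_{\mathfrak{A}}:Sent(\mathcal{S}_{\mathfrak{A}})\to\{0,1\}$ such that, writing $v$ for $v_{\mathfrak A}$: - $v(P(c_1,\dots,c_n))=1$ iff $\langle c_1^{\widehat{\mathfrak{A}}},\dots,c_n^{\widehat{\mathfrak{A}}}\rangle\in P_+^{\mathfrak{A}}$,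 and $v(\neg P(c_1,\dots,c_n))=1$ iff $\langle c_1^{\widehat{\mathfrak{A}}},\dots,c_n^{\widehat{\mathfrak{A}}}\rangle\in P_-^{\mathfrak{A}}$, for all $c_1,\dots,c_n\in\mathcal{C}_{\mathfrak{A}}$; - $v(A\land B)=1$ iff $v(A)=1$ and $v(B)=1$; $v(A\lor B)=1$ iff $v(A)=1$ or $v(B)=1$; - $v(\neg(A\land B))=1$ iff $v(\neg A)=1$ or $v(\neg B)=1$; $v(\neg(A\lor B))=1$ iff $v(\neg A)=1$ and $v(\neg B)=1$; - $v(\neg\neg A)=1$ iff $v(A)=1$; - $v(\forall xA)=1$ iff $v(A(\overline{a}/x))=1$ for every $a\in\mathcal{D}$; $v(\exists xA)=1$ iff $v(A(\overline{a}/x))=1$ for some $a\in\mathcal{D}$; - $v(\neg\forall xA)=1$ iff $v(\neg A(\overline{a}/x))=1$ for some $a\in\mathcal{D}$; $v(\neg\exists xA)=1$ iff $v(\neg A(\overline{a}/x))=1$ for every $a\in\mathcal{D}$. -}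

module Defs where

open import Data.List.Base using (List; []; _∷_; _++_)
import Data.List.Membership.Propositional as List∈
open import Data.List.Relation.Unary.All using (All)
open import Data.List.Relation.Unary.Any using (here; there)
open import Data.Nat.Base using (ℕ)
open import Data.Nat.Properties using (_≟_)
open import Data.Product.Base using (∃-syntax; _×_; _,_)
open import Data.Sum.Base using (_⊎_; inj₁; inj₂; [_,_]′)
open import Data.Sum.Properties using (inj₁-injective)
open import Data.Vec.Base as Vec using (Vec; []; _∷_)
import Data.Vec.Membership.Propositional as Vec∈
open import Data.Vec.Membership.Propositional.Properties using (∈-map⁺)
open import Function.Base using (id)
open import Function.Bundles using (_⇔_)
open import Level using (0ℓ)
open import Relation.Binary.PropositionalEquality
  using (_≡_; _≢_; refl; sym; subst; ≢-sym)
open import Relation.Nullary using (¬_; yes; no; contradiction)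
open import Relation.Unary using (Pred; _∈_)

Infinite : Set → Set
Infinite C = ¬ (∃[ cs ] (∀ (c : C) → c List∈.∈ cs))

-- The predicate letters are given as a family: Letter n is the set of
-- n-ary letters.
record Signature : Set₁ where
  field
    Const    : Set
    infinite : Infinite Const
    Letter   : ℕ → Set
    ≈        : Letter 2

open Signature

Var : Set
Var = ℕ

data Term (S : Signature) : Set where
  var : Var → Term S
  con : Const S → Term S

infix  9 ¬′_
infixr 8 _∧′_
infixr 7 _∨′_

-- The freeness arguments of ∀′ and ∃′ exclude void quantifiers.  They are
-- irrelevant, so that equality of formulas is syntactic identity.
data Formula (S : Signature) : Set

Free : ∀ {S} → Var → Formula S → Set

data Formula S where
  atom : ∀ {n} → Letter S n → Vec (Term S) n → Formula S
  ¬′_  : Formula S → Formula S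
  _∧′_ : Formula S → Formula S → Formula S
  _∨′_ : Formula S → Formula S → Formula S
  ∀′   : (x : Var) (A : Formula S) → .(Free x A) → Formula S
  ∃′   : (x : Var) (A : Formula S) → .(Free x A) → Formula S

Free x (atom P ts) = var x Vec∈.∈ ts
Free x (¬′ A)      = Free x A
Free x (A ∧′ B)    = Free x A ⊎ Free x B
Free x (A ∨′ B)    = Free x A ⊎ Free x B
Free x (∀′ y A _)  = x ≢ y × Free x A
Free x (∃′ y A _)  = x ≢ y × Free x A

Sent : (S : Signature) → Pred (Formula S) 0ℓ
Sent S A = ∀ x → ¬ Free x A

Occurs : ∀ {S} → Const S → Formula S → Set
Occurs c (atom P ts) = con c Vec∈.∈ ts
Occurs c (¬′ A)      = Occurs c A
Occurs c (A ∧′ B)    = Occurs c A ⊎ Occurs c B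
Occurs c (A ∨′ B)    = Occurs c A ⊎ Occurs c B
Occurs c (∀′ _ A _)  = Occurs c A
Occurs c (∃′ _ A _)  = Occurs c A

_≈′_ : ∀ {S} → Const S → Const S → Formula S
_≈′_ {S} c₁ c₂ = atom (≈ S) (con c₁ ∷ con c₂ ∷ [])

-- A [ c / x ] is only needed for a constant c, so no variable capture can
-- arise and quantifiers stay non-void.

_[_/_]ᵗ : ∀ {S} → Term S → Const S → Var → Term S
con d [ c / x ]ᵗ = con d
var y [ c / x ]ᵗ with x ≟ y
... | yes _ = con c
... | no  _ = var y

var-[/]ᵗ : ∀ {S} {c : Const S} {x y} → y ≢ x →
          _≡_ {A = Term S} (var y [ c / x ]ᵗ) (var y)
var-[/]ᵗ {x = x} {y} y≢x with x ≟ y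
... | yes x≡y = contradiction (sym x≡y) y≢x
... | no  _   = refl

_[_/_] : ∀ {S} → Formula S → Const S → Var → Formula S

Free-[/] : ∀ {S} (A : Formula S) {c x y} →
           y ≢ x → Free y A → Free y (A [ c / x ])

atom P ts [ c / x ] = atom P (Vec.map (_[ c / x ]ᵗ) ts)
(¬′ A)    [ c / x ] = ¬′ (A [ c / x ])
(A ∧′ B)  [ c / x ] = A [ c / x ] ∧′ B [ c / x ]
(A ∨′ B)  [ c / x ] = A [ c / x ] ∨′ B [ c / x ]
∀′ y A y∈A [ c / x ] with x ≟ y
... | yes _   = ∀′ y A y∈A
... | no  x≢y = ∀′ y (A [ c / x ]) (Free-[/] A (≢-sym x≢y) y∈A)
∃′ y A y∈A [ c / x ] with x ≟ y
... | yes _   = ∃′ y A y∈A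
... | no  x≢y = ∃′ y (A [ c / x ]) (Free-[/] A (≢-sym x≢y) y∈A)

Free-[/] (atom P ts) {c} {x} y≢x y∈ts =
  subst (Vec∈._∈ Vec.map (_[ c / x ]ᵗ) ts) (var-[/]ᵗ y≢x)
    (∈-map⁺ (_[ c / x ]ᵗ) y∈ts)
Free-[/] (¬′ A)   y≢x f        = Free-[/] A y≢x f
Free-[/] (A ∧′ B) y≢x (inj₁ f) = inj₁ (Free-[/] A y≢x f)
Free-[/] (A ∧′ B) y≢x (inj₂ f) = inj₂ (Free-[/] B y≢x f)
Free-[/] (A ∨′ B) y≢x (inj₁ f) = inj₁ (Free-[/] A y≢x f)
Free-[/] (A ∨′ B) y≢x (inj₂ f) = inj₂ (Free-[/] B y≢x f)
Free-[/] (∀′ z A _) {x = x} y≢x (y≢z , f) with x ≟ z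
... | yes _ = y≢z , f
... | no  _ = y≢z , Free-[/] A y≢x f
Free-[/] (∃′ z A _) {x = x} y≢x (y≢z , f) with x ≟ z
... | yes _ = y≢z , f
... | no  _ = y≢z , Free-[/] A y≢x f

-- Discharge A Δ Δ′: the list Δ′ results from Δ by discharging some
-- (possibly none, possibly all) of the occurrences of A in it.
data Discharge {S} (A : Formula S) : (Δ Δ′ : List (Formula S)) → Set where
  done : Discharge A [] []
  keep : ∀ {B Δ Δ′} → Discharge A Δ Δ′ → Discharge A (B ∷ Δ) (B ∷ Δ′)
  drop : ∀ {Δ Δ′}   → Discharge A Δ Δ′ → Discharge A (A ∷ Δ) Δ′

-- Derivation Δ A: the derivation trees with conclusion A whose undischarged
-- hypotheses (leaf by leaf, from left to right) are exactly Δ.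
-- Only hyp, ∨I and ¬∧I carry a condition that a formula is a sentence; with
-- these, every formula occurring in a derivation is a sentence, and whenever
-- A [ c / x ] occurs in a rule, A has no free variable other than x.
data Derivation {S : Signature} : List (Formula S) → Formula S → Set where

  hyp  : ∀ {A} → A ∈ Sent S → Derivation (A ∷ []) A

  ∧I   : ∀ {Δ₁ Δ₂ A B} →
         Derivation Δ₁ A → Derivation Δ₂ B → Derivation (Δ₁ ++ Δ₂) (A ∧′ B)
  ∧E₁  : ∀ {Δ A B} → Derivation Δ (A ∧′ B) → Derivation Δ A
  ∧E₂  : ∀ {Δ A B} → Derivation Δ (A ∧′ B) → Derivation Δ B

  ∨I₁  : ∀ {Δ A B} → B ∈ Sent S → Derivation Δ A → Derivation Δ (A ∨′ B)
  ∨I₂  : ∀ {Δ A B} → A ∈ Sent S → Derivation Δ B → Derivation Δ (A ∨′ B)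
  ∨E   : ∀ {Δ Δ₁ Δ₁′ Δ₂ Δ₂′ A B C} →
         Derivation Δ (A ∨′ B) →
         Derivation Δ₁ C → Discharge A Δ₁ Δ₁′ →
         Derivation Δ₂ C → Discharge B Δ₂ Δ₂′ →
         Derivation (Δ ++ Δ₁′ ++ Δ₂′) C

  ¬∧I₁ : ∀ {Δ A B} → B ∈ Sent S →
         Derivation Δ (¬′ A) → Derivation Δ (¬′ (A ∧′ B))
  ¬∧I₂ : ∀ {Δ A B} → A ∈ Sent S →
         Derivation Δ (¬′ B) → Derivation Δ (¬′ (A ∧′ B))
  ¬∧E  : ∀ {Δ Δ₁ Δ₁′ Δ₂ Δ₂′ A B C} →
         Derivation Δ (¬′ (A ∧′ B)) →
         Derivation Δ₁ C → Discharge (¬′ A) Δ₁ Δ₁′ →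
         Derivation Δ₂ C → Discharge (¬′ B) Δ₂ Δ₂′ →
         Derivation (Δ ++ Δ₁′ ++ Δ₂′) C

  ¬∨I  : ∀ {Δ₁ Δ₂ A B} →
         Derivation Δ₁ (¬′ A) → Derivation Δ₂ (¬′ B) →
         Derivation (Δ₁ ++ Δ₂) (¬′ (A ∨′ B))
  ¬∨E₁ : ∀ {Δ A B} → Derivation Δ (¬′ (A ∨′ B)) → Derivation Δ (¬′ A)
  ¬∨E₂ : ∀ {Δ A B} → Derivation Δ (¬′ (A ∨′ B)) → Derivation Δ (¬′ B)

  DNI  : ∀ {Δ A} → Derivation Δ A → Derivation Δ (¬′ ¬′ A)
  DNE  : ∀ {Δ A} → Derivation Δ (¬′ ¬′ A) → Derivation Δ A

  ∀I   : ∀ {Δ A B x c} .(x∈A : Free x A) →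
         ¬ Occurs c A → ¬ Occurs c B → All (λ H → ¬ Occurs c H) Δ →
         Derivation Δ (B ∨′ A [ c / x ]) →
         Derivation Δ (B ∨′ ∀′ x A x∈A)
  ∀E   : ∀ {Δ A x} .{x∈A : Free x A} (c : Const S) →
         Derivation Δ (∀′ x A x∈A) → Derivation Δ (A [ c / x ])

  ∃I   : ∀ {Δ A x c} .(x∈A : Free x A) →
         Derivation Δ (A [ c / x ]) → Derivation Δ (∃′ x A x∈A)
  ∃E   : ∀ {Δ₁ Δ₂ Δ₂′ A C x c} .{x∈A : Free x A} →
         ¬ Occurs c A → ¬ Occurs c C → All (λ H → ¬ Occurs c H) Δ₂′ →
         Derivation Δ₁ (∃′ x A x∈A) →
         Derivation Δ₂ C → Discharge (A [ c / x ]) Δ₂ Δ₂′ →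
         Derivation (Δ₁ ++ Δ₂′) C

  ¬∀I  : ∀ {Δ A x c} .(x∈A : Free x A) →
         Derivation Δ (¬′ (A [ c / x ])) → Derivation Δ (¬′ ∀′ x A x∈A)
  ¬∀E  : ∀ {Δ₁ Δ₂ Δ₂′ A C x c} .{x∈A : Free x A} →
         ¬ Occurs c A → ¬ Occurs c C → All (λ H → ¬ Occurs c H) Δ₂′ →
         Derivation Δ₁ (¬′ ∀′ x A x∈A) →
         Derivation Δ₂ C → Discharge (¬′ (A [ c / x ])) Δ₂ Δ₂′ →
         Derivation (Δ₁ ++ Δ₂′) C

  ¬∃I  : ∀ {Δ A x c} .(x∈A : Free x A) →
         ¬ Occurs c A → All (λ H → ¬ Occurs c H) Δ →
         Derivation Δ (¬′ (A [ c / x ])) → Derivation Δ (¬′ ∃′ x A x∈A)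
  ¬∃E  : ∀ {Δ A x} .{x∈A : Free x A} (c : Const S) →
         Derivation Δ (¬′ ∃′ x A x∈A) → Derivation Δ (¬′ (A [ c / x ]))

  ≈I   : ∀ c → Derivation [] (c ≈′ c)
  ≈E   : ∀ {Δ₁ Δ₂ c₁ c₂} A x →
         Derivation Δ₁ (c₁ ≈′ c₂) → Derivation Δ₂ (A [ c₁ / x ]) →
         Derivation (Δ₁ ++ Δ₂) (A [ c₂ / x ])

infix 4 _⊢_

_⊢_ : ∀ {S} → Pred (Formula S) 0ℓ → Formula S → Set
Γ ⊢ A = ∃[ Δ ] (All (_∈ Γ) Δ × Derivation Δ A)

record Structure (S : Signature) : Set₁ where
  field
    Domain   : Set
    nonempty : Domain
    ⟦_⟧      : Const S → Domain
    _⁺ _⁻    : ∀ {n} → Letter S n → Pred (Vec Domain n) 0ℓ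
    ≈⁺       : ∀ {a b} → (a ∷ b ∷ []) ∈ (≈ S ⁺) ⇔ a ≡ b

open Structure using (Domain)

⊎-infinite : ∀ {C} D → Infinite C → Infinite (C ⊎ D)
⊎-infinite {C} D inf (cs , all∈) = inf (lefts cs , λ c → ∈-lefts (all∈ (inj₁ c)))
  where
  lefts : List (C ⊎ D) → List C
  lefts []            = []
  lefts (inj₁ c ∷ cs) = c ∷ lefts cs
  lefts (inj₂ _ ∷ cs) = lefts cs

  ∈-lefts : ∀ {c cs} → inj₁ c List∈.∈ cs → c List∈.∈ lefts cs
  ∈-lefts {cs = inj₁ _ ∷ _} (here eq) = here (inj₁-injective eq)
  ∈-lefts {cs = inj₁ _ ∷ _} (there p) = there (∈-lefts p)
  ∈-lefts {cs = inj₂ _ ∷ _} (there p) = ∈-lefts p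

diagram : ∀ {S} → Structure S → Signature
diagram {S} 𝔄 = record
  { Const    = Const S ⊎ Domain 𝔄
  ; infinite = ⊎-infinite (Domain 𝔄) (infinite S)
  ; Letter   = Letter S
  ; ≈        = ≈ S
  }

name : ∀ {S} (𝔄 : Structure S) → Domain 𝔄 → Const (diagram 𝔄)
name 𝔄 = inj₂

hat : ∀ {S} (𝔄 : Structure S) → Structure (diagram 𝔄)
hat 𝔄 = record
  { Domain   = 𝔄.Domain
  ; nonempty = 𝔄.nonempty
  ; ⟦_⟧      = [ 𝔄.⟦_⟧ , id ]′
  ; _⁺       = 𝔄._⁺
  ; _⁻       = 𝔄._⁻
  ; ≈⁺       = 𝔄.≈⁺
  }
  where module 𝔄 = Structure 𝔄

liftᵗ : ∀ {S} (𝔄 : Structure S) → Term S → Term (diagram 𝔄)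
liftᵗ 𝔄 (var x) = var x
liftᵗ 𝔄 (con c) = con (inj₁ c)

-- The inclusion of Form(𝒮) in Form(𝒮_𝔄).
lift : ∀ {S} (𝔄 : Structure S) → Formula S → Formula (diagram 𝔄)

Free-lift : ∀ {S} (𝔄 : Structure S) (A : Formula S) {x} →
            Free x A → Free x (lift 𝔄 A)

lift 𝔄 (atom P ts)  = atom P (Vec.map (liftᵗ 𝔄) ts)
lift 𝔄 (¬′ A)       = ¬′ lift 𝔄 A
lift 𝔄 (A ∧′ B)     = lift 𝔄 A ∧′ lift 𝔄 B
lift 𝔄 (A ∨′ B)     = lift 𝔄 A ∨′ lift 𝔄 B
lift 𝔄 (∀′ x A x∈A) = ∀′ x (lift 𝔄 A) (Free-lift 𝔄 A x∈A)
lift 𝔄 (∃′ x A x∈A) = ∃′ x (lift 𝔄 A) (Free-lift 𝔄 A x∈A)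

Free-lift 𝔄 (atom P ts) x∈ts     = ∈-map⁺ (liftᵗ 𝔄) x∈ts
Free-lift 𝔄 (¬′ A)     f         = Free-lift 𝔄 A f
Free-lift 𝔄 (A ∧′ B)   (inj₁ f)  = inj₁ (Free-lift 𝔄 A f)
Free-lift 𝔄 (A ∧′ B)   (inj₂ f)  = inj₂ (Free-lift 𝔄 B f)
Free-lift 𝔄 (A ∨′ B)   (inj₁ f)  = inj₁ (Free-lift 𝔄 A f)
Free-lift 𝔄 (A ∨′ B)   (inj₂ f)  = inj₂ (Free-lift 𝔄 B f)
Free-lift 𝔄 (∀′ y A _) (x≢y , f) = x≢y , Free-lift 𝔄 A f
Free-lift 𝔄 (∃′ y A _) (x≢y , f) = x≢y , Free-lift 𝔄 A f

-- v⟨ 𝔄 ⟩ A ≡1 is the relation v_𝔄(A) = 1 on sentences A of the diagram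
-- signature.  In each clause for v_𝔄 the value 1 of the left-hand side is
-- characterised positively by values 1 of simpler sentences; the
-- constructors are the right-to-left halves of the clauses, and the
-- left-to-right halves hold by inversion.
data v⟨_⟩_≡1 {S} (𝔄 : Structure S) : Formula (diagram 𝔄) → Set where

  atom⁺ : ∀ {n} {P : Letter S n} (cs : Vec (Const (diagram 𝔄)) n) →
          Vec.map (Structure.⟦_⟧ (hat 𝔄)) cs ∈ Structure._⁺ 𝔄 P →
          v⟨ 𝔄 ⟩ atom P (Vec.map con cs) ≡1
  atom⁻ : ∀ {n} {P : Letter S n} (cs : Vec (Const (diagram 𝔄)) n) →
          Vec.map (Structure.⟦_⟧ (hat 𝔄)) cs ∈ Structure._⁻ 𝔄 P →
          v⟨ 𝔄 ⟩ (¬′ atom P (Vec.map con cs)) ≡1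

  and   : ∀ {A B} → v⟨ 𝔄 ⟩ A ≡1 × v⟨ 𝔄 ⟩ B ≡1 → v⟨ 𝔄 ⟩ (A ∧′ B) ≡1
  or    : ∀ {A B} → v⟨ 𝔄 ⟩ A ≡1 ⊎ v⟨ 𝔄 ⟩ B ≡1 → v⟨ 𝔄 ⟩ (A ∨′ B) ≡1
  ¬and  : ∀ {A B} → v⟨ 𝔄 ⟩ (¬′ A) ≡1 ⊎ v⟨ 𝔄 ⟩ (¬′ B) ≡1 →
          v⟨ 𝔄 ⟩ (¬′ (A ∧′ B)) ≡1
  ¬or   : ∀ {A B} → v⟨ 𝔄 ⟩ (¬′ A) ≡1 × v⟨ 𝔄 ⟩ (¬′ B) ≡1 →
          v⟨ 𝔄 ⟩ (¬′ (A ∨′ B)) ≡1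
  ¬¬    : ∀ {A} → v⟨ 𝔄 ⟩ A ≡1 → v⟨ 𝔄 ⟩ (¬′ ¬′ A) ≡1

  all   : ∀ {x A} .{x∈A : Free x A} →
          (∀ a → v⟨ 𝔄 ⟩ (A [ name 𝔄 a / x ]) ≡1) → v⟨ 𝔄 ⟩ ∀′ x A x∈A ≡1
  ex    : ∀ {x A} .{x∈A : Free x A} →
          (∃[ a ] v⟨ 𝔄 ⟩ (A [ name 𝔄 a / x ]) ≡1) → v⟨ 𝔄 ⟩ ∃′ x A x∈A ≡1
  ¬all  : ∀ {x A} .{x∈A : Free x A} →
          (∃[ a ] v⟨ 𝔄 ⟩ (¬′ (A [ name 𝔄 a / x ])) ≡1) →
          v⟨ 𝔄 ⟩ (¬′ ∀′ x A x∈A) ≡1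
  ¬ex   : ∀ {x A} .{x∈A : Free x A} →
          (∀ a → v⟨ 𝔄 ⟩ (¬′ (A [ name 𝔄 a / x ])) ≡1) →
          v⟨ 𝔄 ⟩ (¬′ ∃′ x A x∈A) ≡1

infix 4 _⊨_

_⊨_ : ∀ {S} → Pred (Formula S) 0ℓ → Formula S → Set₁
_⊨_ {S} Γ A = (𝔄 : Structure S) →
              (∀ {B} → B ∈ Γ → v⟨ 𝔄 ⟩ lift 𝔄 B ≡1) → v⟨ 𝔄 ⟩ lift 𝔄 A ≡1

{-# OPTIONS --safe #-}
module Submission where

-- Soundness is an induction on derivations in which an eigenconstant is
-- reinterpreted by an arbitrary element of the domain.
--
-- For completeness, every sentence over the enlarged signature gets a witness
-- constant, whose Henkin axiom is the entailment ∃xA ⇒ A(c) or A(c) ⇒ ∀xA (and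
-- dually under ¬).  Without an implication these axioms cannot be hypotheses,
-- so they are met by a pair of a set Θ and a sentence E with Θ ⊬ E: for an
-- axiom P ⇒ Q, either Q is added to Θ or P is added to E as a disjunct, and if
-- both failed then the eigenconstant rules would give Θ ⊢ E.  This needs c to
-- be new, so the axioms are treated in the order in which their constants
-- arise; finitely many of them, and the decision of finitely many sentences,
-- can be met in this way.  The compactness theorem for truth assignments then
-- gives a prime Henkin theory, and its terms modulo ≈ are a countermodel.
--
-- Excluded middle decides types, hence also chooses elements; with
-- extensionality for Boolean predicates it chooses class representatives.

open import Axiom.ExcludedMiddle using (ExcludedMiddle)
open import Axiom.Extensionality.Propositional using (Extensionality; lower-extensionality)
open import Data.Bool.Base using (Bool; true; false; not; T)
open import Data.Empty using (⊥; ⊥-elim; ⊥-elim-irr)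
open import Data.List.Base using (List; []; _∷_; _++_; map; concatMap; deduplicate)
import Data.List.Membership.Propositional as List∈
import Data.List.Membership.Propositional.Properties as List∈
open import Data.List.Properties using (map-++; map-cong-local)
open import Data.List.Relation.Binary.Permutation.Propositional using (↭-sym; ↭⇒↭ₛ)
open import Data.List.Relation.Binary.Permutation.Propositional.Properties using (∈-resp-↭)
import Data.List.Relation.Binary.Permutation.Setoid.Properties as Permₛ
open import Data.List.Relation.Binary.Subset.Propositional using () renaming (_⊆_ to _⊆ˡ_)
open import Data.List.Relation.Unary.All as All using (All; []; _∷_)
import Data.List.Relation.Unary.All.Properties as All
open import Data.List.Relation.Unary.AllPairs as AllPairs using (AllPairs; []; _∷_)
open import Data.List.Relation.Unary.Any using (here; there)
import Data.List.Relation.Unary.Sorted.TotalOrder.Properties as Sorted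
open import Data.List.Relation.Unary.Unique.DecPropositional.Properties using (deduplicate-!)
import Data.List.Sort as Sort
open import Data.Nat.Base using (ℕ; zero; suc; _⊔_; _≤_; s≤s)
open import Data.Nat.Properties
  using (_≟_; ≤-refl; ≤-trans; m≤m⊔n; m≤n⇒m≤o⊔n; m≤n⇒m≤n⊔o; m⊔n≤o⇒m≤o; m⊔n≤o⇒n≤o;
         1+n≰n; ≤-decTotalOrder)
open import Data.Product.Base using (∃-syntax; _×_; _,_; proj₁; proj₂)
open import Data.Product.Function.NonDependent.Propositional using (_×-⇔_)
open import Data.Sum.Base as Sum using (_⊎_; inj₁; inj₂; [_,_]′)
open import Data.Sum.Function.Propositional using (_⊎-⇔_)
open import Data.Sum.Properties using (inj₂-injective)
open import Data.Vec.Base as Vec using (Vec; []; _∷_)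
import Data.Vec.Membership.Propositional as Vec∈
import Data.Vec.Membership.Propositional.Properties as Vec∈
import Data.Vec.Properties as Vec
import Data.Vec.Relation.Unary.Any as VecAny
import Data.Vec.Relation.Unary.Any.Properties as VecAny
open import Function.Base using (_∘_; id; const)
open import Function.Bundles using (_⇔_; mk⇔; Equivalence)
open import Function.Construct.Composition using (_⇔-∘_)
open import Function.Construct.Identity using (⇔-id)
open import Function.Construct.Symmetry using (⇔-sym)
import Level
open import Level using (0ℓ) renaming (suc to lsuc)
open import Relation.Binary.Bundles using (DecTotalOrder)
import Relation.Binary.Construct.On as On
open import Relation.Binary.PropositionalEquality
  using (_≡_; _≢_; refl; sym; trans; cong; cong₂; subst; subst₂; ≢-sym; setoid)
open import Relation.Binary.PropositionalEquality.WithK using (≡-irrelevant)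
open import Relation.Nullary using (Dec; ¬_; yes; no; contradiction; decidable-stable)
open import Relation.Nullary.Decidable using (isYes; fromWitness; toWitness; map′)
open import Relation.Unary using (Pred; _∈_; _∪_; ｛_｝; _⊆_)
open import Defs

open Signature
open Equivalence using (to; from)

-- Maximal consistent sets from excluded middle

module Compactness (em : ExcludedMiddle 0ℓ) (ext : Extensionality 0ℓ 0ℓ) where

  ¬∀⇒∃¬ : {A : Set} {P : A → Set} → ¬ (∀ x → P x) → ∃[ x ] ¬ P x
  ¬∀⇒∃¬ ¬∀ = decidable-stable em λ ¬∃ →
    ¬∀ λ x → decidable-stable em λ ¬Px → ¬∃ (x , ¬Px)

  -- Boolean-valued, so that mutually included subsets are equal by function extensionality and
  -- families of subsets remain in `Set`.
  Subset : Set → Set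
  Subset F = F → Bool

  ⟪_⟫ : {F : Set} → (F → Set) → Subset F
  ⟪ P ⟫ x = isYes (em {P x})

  infix 4 _∈ˢ_ _⊆ˢ_

  _∈ˢ_ : {F : Set} → F → Subset F → Set
  x ∈ˢ X = T (X x)

  _⊆ˢ_ : {F : Set} → Subset F → Subset F → Set
  X ⊆ˢ Y = ∀ {x} → x ∈ˢ X → x ∈ˢ Y

  ⊆ˢ-antisym : {F : Set} {X Y : Subset F} → X ⊆ˢ Y → Y ⊆ˢ X → X ≡ Y
  ⊆ˢ-antisym {X = X} {Y} X⊆Y Y⊆X = ext λ x → T-injective (X x) (Y x) X⊆Y Y⊆X
    where
    T-injective : ∀ a b → (T a → T b) → (T b → T a) → a ≡ b
    T-injective true  true  _ _ = refl
    T-injective false false _ _ = refl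
    T-injective true  false f _ = ⊥-elim (f _)
    T-injective false true  _ g = ⊥-elim (g _)

  -- The Teichmüller–Tukey lemma.  The maximal set is the largest element of
  -- the tower: the smallest family closed under unions and under adding one
  -- further element that keeps consistency, whenever there is one.
  module Tukey {F : Set} (P : List F → Set)
               (P-anti : ∀ {xs ys} → xs ⊆ˡ ys → P ys → P xs) (P[] : P []) where

    Consistent : Subset F → Set
    Consistent X = ∀ xs → All (_∈ˢ X) xs → P xs

    ConsistentWith : F → Subset F → Set
    ConsistentWith y X = ∀ xs → All (_∈ˢ X) xs → P (y ∷ xs)

    Extendible : Subset F → Set
    Extendible X = ∃[ y ] (¬ y ∈ˢ X × ConsistentWith y X)

    add : F → Subset F → Subset F
    add y X = ⟪ (λ z → z ≡ y ⊎ z ∈ˢ X) ⟫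

    -- Excluded middle decides `Extendible X` by exhibiting a particular `y`; the answer depends on
    -- `X` alone, so this serves as a choice function.
    next : Subset F → Subset F
    next X with em {Extendible X}
    ... | yes (y , _) = add y X
    ... | no  _       = X

    ⊆-next : ∀ X → X ⊆ˢ next X
    ⊆-next X x∈X with em {Extendible X}
    ... | yes _ = fromWitness (inj₂ x∈X)
    ... | no  _ = x∈X

    next-fixed : ∀ X → next X ⊆ˢ X → ¬ Extendible X
    next-fixed X next⊆X extendible with em {Extendible X}
    ... | yes (y , y∉X , _)  = y∉X (next⊆X (fromWitness (inj₁ refl)))
    ... | no  ¬extendible    = ¬extendible extendible

    add-consistent : ∀ {y X} → ConsistentWith y X → Consistent (add y X)
    add-consistent {y} {X} ok xs xs⊆ =
      let zs , zs⊆X , xs⊆yzs = split xs xs⊆ in P-anti xs⊆yzs (ok zs zs⊆X)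
      where
      split : ∀ xs → All (_∈ˢ add y X) xs →
              ∃[ zs ] (All (_∈ˢ X) zs × xs ⊆ˡ y ∷ zs)
      split []       []         = [] , [] , λ ()
      split (x ∷ xs) (x∈ ∷ xs⊆) with split xs xs⊆ | toWitness x∈
      ... | zs , zs⊆X , sub | inj₁ refl =
        zs , zs⊆X , λ { (here refl) → here refl ; (there p) → sub p }
      ... | zs , zs⊆X , sub | inj₂ x∈X  =
        x ∷ zs , x∈X ∷ zs⊆X ,
        λ { (here refl) → there (here refl)
          ; (there p)   → weaken (sub p) }
        where
        weaken : ∀ {z} → z List∈.∈ y ∷ zs → z List∈.∈ y ∷ x ∷ zs
        weaken (here eq) = here eq
        weaken (there p) = there (there p)

    next-consistent : ∀ X → Consistent X → Consistent (next X)
    next-consistent X ok with em {Extendible X}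
    ... | yes (_ , _ , ok′) = add-consistent ok′
    ... | no  _             = ok

    ⋃ : Subset (Subset F) → Subset F
    ⋃ Q = ⟪ (λ y → ∃[ X ] (X ∈ˢ Q × y ∈ˢ X)) ⟫

    data Tower : Subset F → Set where
      next∈ : ∀ {X} → Tower X → Tower (next X)
      ⋃∈    : ∀ Q → (∀ X → X ∈ˢ Q → Tower X) → Tower (⋃ Q)

    ∈⋃ : ∀ {Q X y} → X ∈ˢ Q → y ∈ˢ X → y ∈ˢ ⋃ Q
    ∈⋃ X∈Q y∈X = fromWitness (_ , X∈Q , y∈X)

    ⋃⊆ : ∀ {Q Y} → (∀ X → X ∈ˢ Q → X ⊆ˢ Y) → ⋃ Q ⊆ˢ Y
    ⋃⊆ h y∈⋃ with toWitness y∈⋃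
    ... | X , X∈Q , y∈X = h X X∈Q y∈X

    -- A strengthening of linearity: the second alternative speaks of `next Y`, which is the form
    -- that survives induction over the tower.
    Comparable : Subset F → Subset F → Set
    Comparable X Y = X ⊆ˢ Y ⊎ next Y ⊆ˢ X

    -- Induction on the tower up to `Y`. At a successor with `X` and `Y` mutually included,
    -- extensionality makes them equal, and so are their successors. At a union, either every member
    -- lies in `X`, or a member outside `X` is above it and passes its own answer up.
    successor-gap : ∀ {X} → (∀ {Y} → Tower Y → Comparable X Y) →
                    ∀ {Y} → Tower Y → X ⊆ˢ Y → next X ⊆ˢ Y ⊎ Y ⊆ˢ X
    successor-gap {X} cmp (next∈ {Y} tY) X⊆nextY with cmp tY
    ... | inj₂ nextY⊆X = inj₂ nextY⊆X
    ... | inj₁ X⊆Y with successor-gap cmp tY X⊆Y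
    ...   | inj₁ nextX⊆Y = inj₁ (⊆-next Y ∘ nextX⊆Y)
    ...   | inj₂ Y⊆X =
      inj₁ (subst (λ Z → next Z ⊆ˢ next Y) (⊆ˢ-antisym Y⊆X X⊆Y) id)
    successor-gap {X} cmp (⋃∈ Q Q⊆T) X⊆⋃
      with em {∃[ Z ] (Z ∈ˢ Q × ¬ (Z ⊆ˢ X))}
    ... | no  none = inj₂ (⋃⊆ λ Z Z∈Q → decidable-stable em λ Z⊈X →
                             none (Z , Z∈Q , Z⊈X))
    ... | yes (Z , Z∈Q , Z⊈X) with cmp (Q⊆T Z Z∈Q)
    ...   | inj₂ nextZ⊆X = ⊥-elim (Z⊈X (nextZ⊆X ∘ ⊆-next Z))
    ...   | inj₁ X⊆Z with successor-gap cmp (Q⊆T Z Z∈Q) X⊆Z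
    ...     | inj₁ nextX⊆Z = inj₁ (∈⋃ Z∈Q ∘ nextX⊆Z)
    ...     | inj₂ Z⊆X     = ⊥-elim (Z⊈X Z⊆X)

    -- Induction on the first tower set. In the successor case the induction hypothesis, taken for
    -- all `Y`, is exactly what `successor-gap` asks of `X`.
    comparable : ∀ {X Y} → Tower X → Tower Y → Comparable X Y
    comparable (⋃∈ Q Q⊆T) tY with em {∃[ Z ] (Z ∈ˢ Q × ¬ (Z ⊆ˢ _))}
    ... | no  none = inj₁ (⋃⊆ λ Z Z∈Q → decidable-stable em λ Z⊈Y →
                             none (Z , Z∈Q , Z⊈Y))
    ... | yes (Z , Z∈Q , Z⊈Y) with comparable (Q⊆T Z Z∈Q) tY
    ...   | inj₁ Z⊆Y     = ⊥-elim (Z⊈Y Z⊆Y)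
    ...   | inj₂ nextY⊆Z = inj₂ (∈⋃ Z∈Q ∘ nextY⊆Z)
    comparable {Y = Y} (next∈ {X} tX) tY with comparable tX tY
    ... | inj₂ nextY⊆X = inj₂ (⊆-next X ∘ nextY⊆X)
    ... | inj₁ X⊆Y with successor-gap (comparable tX) tY X⊆Y
    ...   | inj₁ nextX⊆Y = inj₁ nextX⊆Y
    ...   | inj₂ Y⊆X =
      inj₂ (subst (λ Z → next Y ⊆ˢ next Z) (⊆ˢ-antisym Y⊆X X⊆Y) id)

    tower-linear : ∀ {X Y} → Tower X → Tower Y → X ⊆ˢ Y ⊎ Y ⊆ˢ X
    tower-linear {Y = Y} tX tY with comparable tX tY
    ... | inj₁ X⊆Y     = inj₁ X⊆Y
    ... | inj₂ nextY⊆X = inj₂ (nextY⊆X ∘ ⊆-next Y)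

    -- By linearity the larger of two members absorbs each further element. The list has a head
    -- because `Q` may be empty.
    ⋃-directed : ∀ {Q} → (∀ X → X ∈ˢ Q → Tower X) → ∀ x xs →
                 All (_∈ˢ ⋃ Q) (x ∷ xs) →
                 ∃[ X ] (X ∈ˢ Q × All (_∈ˢ X) (x ∷ xs))
    ⋃-directed Q⊆T x [] (x∈ ∷ []) with toWitness x∈
    ... | X , X∈Q , x∈X = X , X∈Q , x∈X ∷ []
    ⋃-directed Q⊆T x (y ∷ ys) (x∈ ∷ ys⊆)
      with toWitness x∈ | ⋃-directed Q⊆T y ys ys⊆
    ... | X , X∈Q , x∈X | Y , Y∈Q , ys⊆Y
      with tower-linear (Q⊆T X X∈Q) (Q⊆T Y Y∈Q)
    ...   | inj₁ X⊆Y = Y , Y∈Q , X⊆Y x∈X ∷ ys⊆Y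
    ...   | inj₂ Y⊆X = X , X∈Q , x∈X ∷ All.map Y⊆X ys⊆Y

    tower-consistent : ∀ {X} → Tower X → Consistent X
    tower-consistent (next∈ {X} tX) = next-consistent X (tower-consistent tX)
    -- The family may be empty, so there need not be a member of `Q` to pass to.
    tower-consistent (⋃∈ Q Q⊆T) []       _   = P[]
    tower-consistent (⋃∈ Q Q⊆T) (x ∷ xs) xs⊆ =
      let X , X∈Q , xs⊆X = ⋃-directed Q⊆T x xs xs⊆ in
      tower-consistent (Q⊆T X X∈Q) (x ∷ xs) xs⊆X

    maximal : ∃[ X ] (Consistent X × (∀ y → ConsistentWith y X → y ∈ˢ X))
    maximal = M , tower-consistent M∈T , λ y ok →
      decidable-stable em λ y∉M → next-fixed M nextM⊆M (y , y∉M , ok)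
      where
      M : Subset F
      M = ⋃ ⟪ Tower ⟫

      M∈T : Tower M
      M∈T = ⋃∈ ⟪ Tower ⟫ λ X → toWitness

      -- Being in the tower itself, `next M` is one of the sets united in `M`.
      nextM⊆M : next M ⊆ˢ M
      nextM⊆M = ∈⋃ (fromWitness (next∈ M∈T))

  -- Compactness for truth assignments

  module _ {F : Set} (Good : List F → (F → Bool) → Set)
    (mono  : ∀ {Φ Ψ v} → Φ ⊆ˡ Ψ → Good Ψ v → Good Φ v)
    (local : ∀ {Φ v w} → (∀ {φ} → φ List∈.∈ Φ → v φ ≡ w φ) → Good Φ v → Good Φ w)
    (good  : ∀ Φ → ∃[ v ] Good Φ v) where

    Agrees : (F → Bool) → F × Bool → Set
    Agrees v (φ , b) = v φ ≡ b

    Extends : List F → List (F × Bool) → Set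
    Extends Φ xs = ∃[ v ] (Good Φ v × All (Agrees v) xs)

    -- The consistency notion to which the Tukey lemma is applied; a list of pairs prescribes
    -- finitely many truth values.
    FinitelyExtendible : List (F × Bool) → Set
    FinitelyExtendible xs = ∀ Φ → Extends Φ xs

    FinitelyExtendible-anti : ∀ {xs ys} → xs ⊆ˡ ys →
                              FinitelyExtendible ys → FinitelyExtendible xs
    FinitelyExtendible-anti xs⊆ys fin Φ =
      let v , gd , agr = fin Φ in v , gd , All.anti-mono xs⊆ys agr

    FinitelyExtendible-[] : FinitelyExtendible []
    FinitelyExtendible-[] Φ = let v , gd = good Φ in v , gd , []

    open Tukey FinitelyExtendible FinitelyExtendible-anti FinitelyExtendible-[] using (maximal)

    -- The maximal set is the graph of a total assignment: if both values at `φ` were blocked, the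
    -- two blocking lists and the two finite sets would together refute the consistency of `X`.
    -- Goodness on `Φ` is then transferred by `local` from an assignment that meets the graph of `v`
    -- over `Φ`.
    compactness : ∃[ v ] (∀ Φ → Good Φ v)
    compactness with maximal
    ... | X , ok , max = v , all-good
      where
      v : F → Bool
      v φ = X (φ , true)

      blocked : ∀ {y} → ¬ y ∈ˢ X →
                ∃[ xs ] (All (_∈ˢ X) xs × ∃[ Φ ] ¬ Extends Φ (y ∷ xs))
      blocked y∉X with ¬∀⇒∃¬ (y∉X ∘ max _)
      ... | xs , ¬h with ¬∀⇒∃¬ ¬h
      ...   | xs⊆X , ¬e = xs , xs⊆X , ¬∀⇒∃¬ ¬e

      total : ∀ φ → (φ , v φ) ∈ˢ X
      total φ with X (φ , true) in eq
      ... | true  = subst T (sym eq) _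
      ... | false = decidable-stable em λ f∉X →
        let xs , xs⊆X , Φ , ¬e  = blocked (subst T eq)
            ys , ys⊆X , Ψ , ¬e′ = blocked f∉X
            w , gd , agr = ok (xs ++ ys) (All.++⁺ xs⊆X ys⊆X) (Φ ++ Ψ)
        in refute xs Φ w gd agr ¬e ¬e′
        where
        refute : ∀ xs {ys} Φ {Ψ} w → Good (Φ ++ Ψ) w →
                 All (Agrees w) (xs ++ ys) → ¬ Extends Φ ((φ , true) ∷ xs) →
                 ¬ ¬ Extends Ψ ((φ , false) ∷ ys)
        refute xs Φ w gd agr ¬e ¬e′ with w φ in wφ
        ... | true  = ¬e  (w , mono List∈.∈-++⁺ˡ gd , wφ ∷ All.++⁻ˡ xs agr)
        ... | false = ¬e′ (w , mono (List∈.∈-++⁺ʳ Φ) gd , wφ ∷ All.++⁻ʳ xs agr)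

      all-good : ∀ Φ → Good Φ v
      all-good Φ with ok (map (λ φ → φ , v φ) Φ) (All.map⁺ (All.tabulate λ {φ} _ → total φ)) Φ
      ... | w , gd , agr = local (λ φ∈Φ → All.lookup agr (List∈.∈-map⁺ _ φ∈Φ)) gd

-- Free variables and constants under substitution

∈-map⁻ : ∀ {A B : Set} {n} (f : A → B) (xs : Vec A n) {y} → y Vec∈.∈ Vec.map f xs →
         ∃[ x ] (x Vec∈.∈ xs × y ≡ f x)
∈-map⁻ f xs p = Vec∈.fromAny (VecAny.map⁻ p)

∀′-cong : ∀ {S x} {A B : Formula S} → A ≡ B → .{p : Free x A} .{q : Free x B} →
          ∀′ x A p ≡ ∀′ x B q
∀′-cong refl = refl

∃′-cong : ∀ {S x} {A B : Formula S} → A ≡ B → .{p : Free x A} .{q : Free x B} →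
          ∃′ x A p ≡ ∃′ x B q
∃′-cong refl = refl

var-[/]ᵗ⁻ : ∀ {S} {c : Const S} {x y} (t : Term S) →
            var y ≡ t [ c / x ]ᵗ → t ≡ var y × y ≢ x
var-[/]ᵗ⁻ {x = x} (var z) eq with x ≟ z
var-[/]ᵗ⁻ (var z) ()   | yes _
var-[/]ᵗ⁻ (var z) refl | no x≢z = refl , ≢-sym x≢z

Free-[/]⁻ : ∀ {S} (A : Formula S) {c x y} →
            Free y (A [ c / x ]) → y ≢ x × Free y A
Free-[/]⁻ (atom P ts) {c} {x} f with ∈-map⁻ (_[ c / x ]ᵗ) ts f
... | t , t∈ts , eq with var-[/]ᵗ⁻ t eq
...   | refl , y≢x = y≢x , t∈ts
Free-[/]⁻ (¬′ A)   f        = Free-[/]⁻ A f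
Free-[/]⁻ (A ∧′ B) (inj₁ f) = let p , q = Free-[/]⁻ A f in p , inj₁ q
Free-[/]⁻ (A ∧′ B) (inj₂ f) = let p , q = Free-[/]⁻ B f in p , inj₂ q
Free-[/]⁻ (A ∨′ B) (inj₁ f) = let p , q = Free-[/]⁻ A f in p , inj₁ q
Free-[/]⁻ (A ∨′ B) (inj₂ f) = let p , q = Free-[/]⁻ B f in p , inj₂ q
Free-[/]⁻ (∀′ z A _) {x = x} f with x ≟ z
Free-[/]⁻ (∀′ z A _) (y≢z , f) | yes refl = y≢z , y≢z , f
Free-[/]⁻ (∀′ z A _) (y≢z , f) | no _ = let p , q = Free-[/]⁻ A f in p , y≢z , q
Free-[/]⁻ (∃′ z A _) {x = x} f with x ≟ z
Free-[/]⁻ (∃′ z A _) (y≢z , f) | yes refl = y≢z , y≢z , f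
Free-[/]⁻ (∃′ z A _) (y≢z , f) | no _ = let p , q = Free-[/]⁻ A f in p , y≢z , q

Sent-[/] : ∀ {S x} (A : Formula S) → (∀ y → y ≢ x → ¬ Free y A) →
           ∀ c → A [ c / x ] ∈ Sent S
Sent-[/] A s c y f = let y≢x , f′ = Free-[/]⁻ A f in s y y≢x f′

Occurs-[/]ᵗ⁻ : ∀ {S} {c d : Const S} {x} (t : Term S) →
               con d ≡ t [ c / x ]ᵗ → t ≡ con d ⊎ d ≡ c
Occurs-[/]ᵗ⁻ {x = x} (var y) eq with x ≟ y
Occurs-[/]ᵗ⁻ (var y) refl | yes _ = inj₂ refl
Occurs-[/]ᵗ⁻ (var y) ()   | no _
Occurs-[/]ᵗ⁻ (con d) refl = inj₁ refl

Occurs-[/]⁻ : ∀ {S} (A : Formula S) {c d x} →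
              Occurs d (A [ c / x ]) → Occurs d A ⊎ d ≡ c
Occurs-[/]⁻ (atom P ts) {c} {d} {x} o with ∈-map⁻ (_[ c / x ]ᵗ) ts o
... | t , t∈ts , eq with Occurs-[/]ᵗ⁻ t eq
...   | inj₁ refl = inj₁ t∈ts
...   | inj₂ d≡c  = inj₂ d≡c
Occurs-[/]⁻ (¬′ A)   o        = Occurs-[/]⁻ A o
Occurs-[/]⁻ (A ∧′ B) (inj₁ o) = Sum.map₁ inj₁ (Occurs-[/]⁻ A o)
Occurs-[/]⁻ (A ∧′ B) (inj₂ o) = Sum.map₁ inj₂ (Occurs-[/]⁻ B o)
Occurs-[/]⁻ (A ∨′ B) (inj₁ o) = Sum.map₁ inj₁ (Occurs-[/]⁻ A o)
Occurs-[/]⁻ (A ∨′ B) (inj₂ o) = Sum.map₁ inj₂ (Occurs-[/]⁻ B o)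
Occurs-[/]⁻ (∀′ y A _) {x = x} o with x ≟ y
... | yes _ = inj₁ o
... | no  _ = Occurs-[/]⁻ A o
Occurs-[/]⁻ (∃′ y A _) {x = x} o with x ≟ y
... | yes _ = inj₁ o
... | no  _ = Occurs-[/]⁻ A o

-- Renaming of constants

-- The diagram signature and the Henkin signature both have this form. The letters stay
-- definitionally the same, so relations on a domain interpret all these signatures at once.
_⟨_,_⟩ : (S : Signature) (C : Set) → Infinite C → Signature
S ⟨ C , inf ⟩ = record
  { Const = C ; infinite = inf ; Letter = Letter S ; ≈ = ≈ S }

module _ {S : Signature} {C : Set} {inf : Infinite C} where

  renameᵗ : (Const S → C) → Term S → Term (S ⟨ C , inf ⟩)
  renameᵗ f (var x) = var x
  renameᵗ f (con c) = con (f c)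

  rename : (Const S → C) → Formula S → Formula (S ⟨ C , inf ⟩)

  Free-rename : ∀ f (A : Formula S) {x} → Free x A → Free x (rename f A)

  rename f (atom P ts)  = atom P (Vec.map (renameᵗ f) ts)
  rename f (¬′ A)       = ¬′ rename f A
  rename f (A ∧′ B)     = rename f A ∧′ rename f B
  rename f (A ∨′ B)     = rename f A ∨′ rename f B
  rename f (∀′ x A x∈A) = ∀′ x (rename f A) (Free-rename f A x∈A)
  rename f (∃′ x A x∈A) = ∃′ x (rename f A) (Free-rename f A x∈A)

  Free-rename f (atom P ts) x∈ts     = Vec∈.∈-map⁺ (renameᵗ f) x∈ts
  Free-rename f (¬′ A)     p         = Free-rename f A p
  Free-rename f (A ∧′ B)   (inj₁ p)  = inj₁ (Free-rename f A p)
  Free-rename f (A ∧′ B)   (inj₂ p)  = inj₂ (Free-rename f B p)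
  Free-rename f (A ∨′ B)   (inj₁ p)  = inj₁ (Free-rename f A p)
  Free-rename f (A ∨′ B)   (inj₂ p)  = inj₂ (Free-rename f B p)
  Free-rename f (∀′ y A _) (x≢y , p) = x≢y , Free-rename f A p
  Free-rename f (∃′ y A _) (x≢y , p) = x≢y , Free-rename f A p

  var-renameᵗ⁻ : ∀ {f x} (t : Term S) → var x ≡ renameᵗ f t → t ≡ var x
  var-renameᵗ⁻ (var x) refl = refl

  Free-rename⁻ : ∀ f (A : Formula S) {x} → Free x (rename f A) → Free x A
  Free-rename⁻ f (atom P ts) p with ∈-map⁻ (renameᵗ f) ts p
  ... | t , t∈ts , eq with var-renameᵗ⁻ t eq
  ...   | refl = t∈ts
  Free-rename⁻ f (¬′ A)     p         = Free-rename⁻ f A p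
  Free-rename⁻ f (A ∧′ B)   (inj₁ p)  = inj₁ (Free-rename⁻ f A p)
  Free-rename⁻ f (A ∧′ B)   (inj₂ p)  = inj₂ (Free-rename⁻ f B p)
  Free-rename⁻ f (A ∨′ B)   (inj₁ p)  = inj₁ (Free-rename⁻ f A p)
  Free-rename⁻ f (A ∨′ B)   (inj₂ p)  = inj₂ (Free-rename⁻ f B p)
  Free-rename⁻ f (∀′ y A _) (x≢y , p) = x≢y , Free-rename⁻ f A p
  Free-rename⁻ f (∃′ y A _) (x≢y , p) = x≢y , Free-rename⁻ f A p

  Sent-rename : ∀ f (A : Formula S) → A ∈ Sent S → rename f A ∈ Sent (S ⟨ C , inf ⟩)
  Sent-rename f A s x = s x ∘ Free-rename⁻ f A

  con-renameᵗ⁻ : ∀ {f d} (t : Term S) → con d ≡ renameᵗ f t → ∃[ c ] (t ≡ con c × d ≡ f c)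
  con-renameᵗ⁻ (con c) refl = c , refl , refl

  Occurs-rename⁻ : ∀ f (A : Formula S) {d} → Occurs d (rename f A) →
                   ∃[ c ] (Occurs c A × d ≡ f c)
  Occurs-rename⁻ f (atom P ts) p with ∈-map⁻ (renameᵗ f) ts p
  ... | t , t∈ts , eq with con-renameᵗ⁻ t eq
  ...   | c , refl , d≡fc = c , t∈ts , d≡fc
  Occurs-rename⁻ f (¬′ A)     p        = Occurs-rename⁻ f A p
  Occurs-rename⁻ f (A ∧′ B)   (inj₁ p) = let c , o , eq = Occurs-rename⁻ f A p in c , inj₁ o , eq
  Occurs-rename⁻ f (A ∧′ B)   (inj₂ p) = let c , o , eq = Occurs-rename⁻ f B p in c , inj₂ o , eq
  Occurs-rename⁻ f (A ∨′ B)   (inj₁ p) = let c , o , eq = Occurs-rename⁻ f A p in c , inj₁ o , eq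
  Occurs-rename⁻ f (A ∨′ B)   (inj₂ p) = let c , o , eq = Occurs-rename⁻ f B p in c , inj₂ o , eq
  Occurs-rename⁻ f (∀′ y A _) p        = Occurs-rename⁻ f A p
  Occurs-rename⁻ f (∃′ y A _) p        = Occurs-rename⁻ f A p

  renameᵗ-[/] : ∀ f c x (t : Term S) →
                renameᵗ f (t [ c / x ]ᵗ) ≡ renameᵗ f t [ f c / x ]ᵗ
  renameᵗ-[/] f c x (con d) = refl
  renameᵗ-[/] f c x (var y) with x ≟ y
  ... | yes _ = refl
  ... | no  _ = refl

  rename-[/] : ∀ f c x (A : Formula S) →
               rename f (A [ c / x ]) ≡ rename f A [ f c / x ]
  rename-[/] f c x (atom P ts) = cong (atom P)
    (trans (sym (Vec.map-∘ _ _ ts))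
      (trans (Vec.map-cong (renameᵗ-[/] f c x) ts) (Vec.map-∘ _ _ ts)))
  rename-[/] f c x (¬′ A)   = cong ¬′_ (rename-[/] f c x A)
  rename-[/] f c x (A ∧′ B) = cong₂ _∧′_ (rename-[/] f c x A) (rename-[/] f c x B)
  rename-[/] f c x (A ∨′ B) = cong₂ _∨′_ (rename-[/] f c x A) (rename-[/] f c x B)
  rename-[/] f c x (∀′ y A _) with x ≟ y
  ... | yes _ = refl
  ... | no  _ = ∀′-cong (rename-[/] f c x A)
  rename-[/] f c x (∃′ y A _) with x ≟ y
  ... | yes _ = refl
  ... | no  _ = ∃′-cong (rename-[/] f c x A)

  rename-cong : ∀ {f g} (A : Formula S) → (∀ {c} → Occurs c A → f c ≡ g c) →
                rename f A ≡ rename g A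
  rename-cong {f} {g} (atom P ts) eq = cong (atom P) (go ts eq)
    where
    go : ∀ {n} (ts : Vec (Term S) n) → (∀ {c} → con c Vec∈.∈ ts → f c ≡ g c) →
         Vec.map (renameᵗ f) ts ≡ Vec.map (renameᵗ g) ts
    go []           eq = refl
    go (var x ∷ ts) eq = cong (_ ∷_) (go ts (eq ∘ VecAny.there))
    go (con c ∷ ts) eq =
      cong₂ (λ d us → con d ∷ us) (eq (VecAny.here refl)) (go ts (eq ∘ VecAny.there))
  rename-cong (¬′ A)     eq = cong ¬′_ (rename-cong A eq)
  rename-cong (A ∧′ B)   eq = cong₂ _∧′_ (rename-cong A (eq ∘ inj₁)) (rename-cong B (eq ∘ inj₂))
  rename-cong (A ∨′ B)   eq = cong₂ _∨′_ (rename-cong A (eq ∘ inj₁)) (rename-cong B (eq ∘ inj₂))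
  rename-cong (∀′ x A _) eq = ∀′-cong (rename-cong A eq)
  rename-cong (∃′ x A _) eq = ∃′-cong (rename-cong A eq)

rename-inverse : ∀ {S C} {inf : Infinite C} (f : Const S → C) (g : C → Const S) →
                 (∀ c → g (f c) ≡ c) → (A : Formula S) →
                 rename g (rename {inf = inf} f A) ≡ A
rename-inverse {S} f g inv (atom P ts) =
  cong (atom P) (trans (sym (Vec.map-∘ _ _ ts)) (trans (Vec.map-cong invᵗ ts) (Vec.map-id ts)))
  where
  invᵗ : ∀ (t : Term S) → renameᵗ g (renameᵗ f t) ≡ t
  invᵗ (var x) = refl
  invᵗ (con c) = cong con (inv c)
rename-inverse f g inv (¬′ A)     = cong ¬′_ (rename-inverse f g inv A)
rename-inverse f g inv (A ∧′ B)   = cong₂ _∧′_ (rename-inverse f g inv A) (rename-inverse f g inv B)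
rename-inverse f g inv (A ∨′ B)   = cong₂ _∨′_ (rename-inverse f g inv A) (rename-inverse f g inv B)
rename-inverse f g inv (∀′ x A _) = ∀′-cong (rename-inverse f g inv A)
rename-inverse f g inv (∃′ x A _) = ∃′-cong (rename-inverse f g inv A)

-- Fresh constants and renaming in derivations

constantsᵗ : ∀ {S n} → Vec (Term S) n → List (Const S)
constantsᵗ []           = []
constantsᵗ (var _ ∷ ts) = constantsᵗ ts
constantsᵗ (con c ∷ ts) = c ∷ constantsᵗ ts

∈-constantsᵗ : ∀ {S n} (ts : Vec (Term S) n) {c} → con c Vec∈.∈ ts →
               c List∈.∈ constantsᵗ ts
∈-constantsᵗ (var _ ∷ ts) (VecAny.there p)   = ∈-constantsᵗ ts p
∈-constantsᵗ (con _ ∷ ts) (VecAny.here refl) = here refl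
∈-constantsᵗ (con _ ∷ ts) (VecAny.there p)   = there (∈-constantsᵗ ts p)

constants : ∀ {S} → Formula S → List (Const S)
constants (atom P ts) = constantsᵗ ts
constants (¬′ A)      = constants A
constants (A ∧′ B)    = constants A ++ constants B
constants (A ∨′ B)    = constants A ++ constants B
constants (∀′ _ A _)  = constants A
constants (∃′ _ A _)  = constants A

∈-constants : ∀ {S} (A : Formula S) {c} → Occurs c A → c List∈.∈ constants A
∈-constants (atom P ts) o       = ∈-constantsᵗ ts o
∈-constants (¬′ A)     o        = ∈-constants A o
∈-constants (A ∧′ B)   (inj₁ o) = List∈.∈-++⁺ˡ (∈-constants A o)
∈-constants (A ∧′ B)   (inj₂ o) = List∈.∈-++⁺ʳ (constants A) (∈-constants B o)
∈-constants (A ∨′ B)   (inj₁ o) = List∈.∈-++⁺ˡ (∈-constants A o)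
∈-constants (A ∨′ B)   (inj₂ o) = List∈.∈-++⁺ʳ (constants A) (∈-constants B o)
∈-constants (∀′ _ A _) o        = ∈-constants A o
∈-constants (∃′ _ A _) o        = ∈-constants A o

module RenameDerivation (em : ExcludedMiddle 0ℓ) where

  -- Otherwise the constants of `As` would exhaust `Const S`, against `infinite`.
  fresh : ∀ {S} (As : List (Formula S)) → ∃[ d ] All (λ A → ¬ Occurs d A) As
  fresh {S} As with em {∃[ d ] ¬ (d List∈.∈ concatMap constants As)}
  ... | yes (d , d∉) = d , All.tabulate λ {A} A∈As o →
    d∉ (List∈.∈-concatMap⁺ constants (List∈.lose A∈As (∈-constants A o)))
  ... | no  none     = ⊥-elim (infinite S (concatMap constants As , λ d →
    decidable-stable em λ d∉ → none (d , d∉)))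

  -- Stated for arbitrary sets, as it updates renamings of constants here and evaluations of terms
  -- in the soundness proof.
  _[_↦_]ᶜ : {C D : Set} → (C → D) → C → D → C → D
  (f [ c ↦ d ]ᶜ) c′ with em {c′ ≡ c}
  ... | yes _ = d
  ... | no  _ = f c′

  ↦-hit : {C D : Set} (f : C → D) (c : C) {d : D} → (f [ c ↦ d ]ᶜ) c ≡ d
  ↦-hit f c with em {c ≡ c}
  ... | yes _  = refl
  ... | no c≢c = contradiction refl c≢c

  ↦-miss : {C D : Set} (f : C → D) {c c′ : C} {d : D} → c′ ≢ c →
           (f [ c ↦ d ]ᶜ) c′ ≡ f c′
  ↦-miss f {c} {c′} c′≢c with em {c′ ≡ c}
  ... | yes eq = contradiction eq c′≢c
  ... | no  _  = refl

  module _ {S : Signature} {C : Set} {inf : Infinite C} where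

    private
      R : (Const S → C) → Formula S → Formula (S ⟨ C , inf ⟩)
      R = rename

    rename-↦ : ∀ f {c d} (A : Formula S) → ¬ Occurs c A → R (f [ c ↦ d ]ᶜ) A ≡ R f A
    rename-↦ f A c∉A = rename-cong A λ o → ↦-miss f λ { refl → c∉A o }

    rename-↦-[/] : ∀ f {c d x} (A : Formula S) → ¬ Occurs c A →
                   R (f [ c ↦ d ]ᶜ) (A [ c / x ]) ≡ R f A [ d / x ]
    rename-↦-[/] f {c} {d} {x} A c∉A =
      trans (rename-[/] _ c x A)
        (cong₂ (λ B e → B [ e / x ]) (rename-↦ f A c∉A) (↦-hit f c))

    rename-↦-map : ∀ f {c d} {Δ : List (Formula S)} → All (λ H → ¬ Occurs c H) Δ →
                   map (R (f [ c ↦ d ]ᶜ)) Δ ≡ map (R f) Δ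
    rename-↦-map f c∉Δ = map-cong-local (All.map (λ {A} → rename-↦ f A) c∉Δ)

    rename-Discharge : ∀ f {A : Formula S} {Δ Δ′} → Discharge A Δ Δ′ →
                       Discharge (R f A) (map (R f) Δ) (map (R f) Δ′)
    rename-Discharge f done     = done
    rename-Discharge f (keep d) = keep (rename-Discharge f d)
    rename-Discharge f (drop d) = drop (rename-Discharge f d)

    private
      split₂ : ∀ f (Δ₁ : List (Formula S)) {Δ₂ A} →
               Derivation (map (R f) Δ₁ ++ map (R f) Δ₂) A →
               Derivation (map (R f) (Δ₁ ++ Δ₂)) A
      split₂ f Δ₁ {Δ₂} = subst (λ Δ → Derivation Δ _) (sym (map-++ (R f) Δ₁ Δ₂))

      split₃ : ∀ f (Δ₁ Δ₂ : List (Formula S)) {Δ₃ A} →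
               Derivation (map (R f) Δ₁ ++ map (R f) Δ₂ ++ map (R f) Δ₃) A →
               Derivation (map (R f) (Δ₁ ++ Δ₂ ++ Δ₃)) A
      split₃ f Δ₁ Δ₂ {Δ₃} D = split₂ f Δ₁
        (subst (λ Δ → Derivation (map (R f) Δ₁ ++ Δ) _) (sym (map-++ (R f) Δ₂ Δ₃)) D)

    -- An eigenconstant is sent to a constant fresh for the renamed rule
    -- instance, so the renaming need not be injective.
    rename-Derivation : ∀ {Δ A} → Derivation Δ A → ∀ f → Derivation (map (R f) Δ) (R f A)
    rename-Derivation (hyp {A} s) f = hyp (Sent-rename f A s)
    rename-Derivation (∧I {Δ₁} D₁ D₂) f =
      split₂ f Δ₁ (∧I (rename-Derivation D₁ f) (rename-Derivation D₂ f))
    rename-Derivation (∧E₁ D) f = ∧E₁ (rename-Derivation D f)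
    rename-Derivation (∧E₂ D) f = ∧E₂ (rename-Derivation D f)
    rename-Derivation (∨I₁ {B = B} s D) f = ∨I₁ (Sent-rename f B s) (rename-Derivation D f)
    rename-Derivation (∨I₂ {A = A} s D) f = ∨I₂ (Sent-rename f A s) (rename-Derivation D f)
    rename-Derivation (∨E {Δ} {Δ₁′ = Δ₁′} D D₁ d₁ D₂ d₂) f =
      split₃ f Δ Δ₁′ (∨E (rename-Derivation D f)
        (rename-Derivation D₁ f) (rename-Discharge f d₁)
        (rename-Derivation D₂ f) (rename-Discharge f d₂))
    rename-Derivation (¬∧I₁ {B = B} s D) f = ¬∧I₁ (Sent-rename f B s) (rename-Derivation D f)
    rename-Derivation (¬∧I₂ {A = A} s D) f = ¬∧I₂ (Sent-rename f A s) (rename-Derivation D f)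
    rename-Derivation (¬∧E {Δ} {Δ₁′ = Δ₁′} D D₁ d₁ D₂ d₂) f =
      split₃ f Δ Δ₁′ (¬∧E (rename-Derivation D f)
        (rename-Derivation D₁ f) (rename-Discharge f d₁)
        (rename-Derivation D₂ f) (rename-Discharge f d₂))
    rename-Derivation (¬∨I {Δ₁} D₁ D₂) f =
      split₂ f Δ₁ (¬∨I (rename-Derivation D₁ f) (rename-Derivation D₂ f))
    rename-Derivation (¬∨E₁ D) f = ¬∨E₁ (rename-Derivation D f)
    rename-Derivation (¬∨E₂ D) f = ¬∨E₂ (rename-Derivation D f)
    rename-Derivation (DNI D) f = DNI (rename-Derivation D f)
    rename-Derivation (DNE D) f = DNE (rename-Derivation D f)
    rename-Derivation (∀I {Δ} {A} {B} {x} {c} p c∉A c∉B c∉Δ D) f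
      with fresh (R f A ∷ R f B ∷ map (R f) Δ)
    ... | d , d∉A ∷ d∉B ∷ d∉Δ =
      ∀I (Free-rename f A p) d∉A d∉B d∉Δ
        (subst₂ Derivation (rename-↦-map f c∉Δ)
          (cong₂ _∨′_ (rename-↦ f B c∉B) (rename-↦-[/] f A c∉A))
          (rename-Derivation D (f [ c ↦ d ]ᶜ)))
    rename-Derivation (∀E {A = A} {x} c D) f =
      subst (Derivation _) (sym (rename-[/] f c x A)) (∀E (f c) (rename-Derivation D f))
    rename-Derivation (∃I {A = A} {x} {c} p D) f =
      ∃I (Free-rename f A p)
        (subst (Derivation _) (rename-[/] f c x A) (rename-Derivation D f))
    rename-Derivation (∃E {Δ₁} {Δ₂} {Δ₂′} {A} {C} {x} {c} c∉A c∉C c∉Δ D₁ D₂ dis) f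
      with fresh (R f A ∷ R f C ∷ map (R f) Δ₂′)
    ... | d , d∉A ∷ d∉C ∷ d∉Δ =
      split₂ f Δ₁ (∃E d∉A d∉C d∉Δ (rename-Derivation D₁ f)
        (subst (Derivation _) (rename-↦ f C c∉C) (rename-Derivation D₂ (f [ c ↦ d ]ᶜ)))
        (subst₂ (λ B → Discharge B (map (R (f [ c ↦ d ]ᶜ)) Δ₂)) (rename-↦-[/] f A c∉A)
          (rename-↦-map f c∉Δ)
          (rename-Discharge (f [ c ↦ d ]ᶜ) dis)))
    rename-Derivation (¬∀I {A = A} {x} {c} p D) f =
      ¬∀I (Free-rename f A p)
        (subst (Derivation _) (cong ¬′_ (rename-[/] f c x A)) (rename-Derivation D f))
    rename-Derivation (¬∀E {Δ₁} {Δ₂} {Δ₂′} {A} {C} {x} {c} c∉A c∉C c∉Δ D₁ D₂ dis) f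
      with fresh (R f A ∷ R f C ∷ map (R f) Δ₂′)
    ... | d , d∉A ∷ d∉C ∷ d∉Δ =
      split₂ f Δ₁ (¬∀E d∉A d∉C d∉Δ (rename-Derivation D₁ f)
        (subst (Derivation _) (rename-↦ f C c∉C) (rename-Derivation D₂ (f [ c ↦ d ]ᶜ)))
        (subst₂ (λ B → Discharge B (map (R (f [ c ↦ d ]ᶜ)) Δ₂))
          (cong ¬′_ (rename-↦-[/] f A c∉A)) (rename-↦-map f c∉Δ)
          (rename-Discharge (f [ c ↦ d ]ᶜ) dis)))
    rename-Derivation (¬∃I {Δ} {A} {x} {c} p c∉A c∉Δ D) f
      with fresh (R f A ∷ map (R f) Δ)
    ... | d , d∉A ∷ d∉Δ =
      ¬∃I (Free-rename f A p) d∉A d∉Δ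
        (subst₂ Derivation (rename-↦-map f c∉Δ) (cong ¬′_ (rename-↦-[/] f A c∉A))
          (rename-Derivation D (f [ c ↦ d ]ᶜ)))
    rename-Derivation (¬∃E {A = A} {x} c D) f =
      subst (Derivation _) (cong ¬′_ (sym (rename-[/] f c x A)))
        (¬∃E (f c) (rename-Derivation D f))
    rename-Derivation (≈I c) f = ≈I (f c)
    rename-Derivation (≈E {Δ₁} {c₁ = c₁} {c₂} A x D₁ D₂) f =
      split₂ f Δ₁ (subst (Derivation _) (sym (rename-[/] f c₂ x A))
        (≈E (R f A) x (rename-Derivation D₁ f)
          (subst (Derivation _) (rename-[/] f c₁ x A) (rename-Derivation D₂ f))))

-- Satisfaction under evaluations of terms

Π-⇔ : {D : Set} {P Q : D → Set} → (∀ d → P d ⇔ Q d) → (∀ d → P d) ⇔ (∀ d → Q d)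
Π-⇔ eq = mk⇔ (λ p d → to (eq d) (p d)) (λ q d → from (eq d) (q d))

∃-⇔ : {D : Set} {P Q : D → Set} → (∀ d → P d ⇔ Q d) → (∃[ d ] P d) ⇔ (∃[ d ] Q d)
∃-⇔ eq = mk⇔ (λ (d , p) → d , to (eq d) p) (λ (d , q) → d , from (eq d) q)

_[_↦_] : ∀ {S} {D : Set} → (Term S → D) → Var → D → Term S → D
(e [ x ↦ d ]) (con c) = e (con c)
(e [ x ↦ d ]) (var y) with x ≟ y
... | yes _ = d
... | no  _ = e (var y)

-- A literal is read in the extension (true) or anti-extension (false) of its
-- letter.
Relations : Signature → Set → Set₁
Relations S D = Bool → ∀ {n} → Letter S n → Pred (Vec D n) 0ℓ

-- Sat R true e A and Sat R false e A say that A and ¬′ A have value 1.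
Sat : ∀ {S D} → Relations S D → Bool → (Term S → D) → Formula S → Set
Sat R b     e (atom P ts) = Vec.map e ts ∈ R b P
Sat R b     e (¬′ A)      = Sat R (not b) e A
Sat R true  e (A ∧′ B)    = Sat R true e A × Sat R true e B
Sat R false e (A ∧′ B)    = Sat R false e A ⊎ Sat R false e B
Sat R true  e (A ∨′ B)    = Sat R true e A ⊎ Sat R true e B
Sat R false e (A ∨′ B)    = Sat R false e A × Sat R false e B
Sat R true  e (∀′ x A _)  = ∀ d → Sat R true (e [ x ↦ d ]) A
Sat R false e (∀′ x A _)  = ∃[ d ] Sat R false (e [ x ↦ d ]) A
Sat R true  e (∃′ x A _)  = ∃[ d ] Sat R true (e [ x ↦ d ]) A
Sat R false e (∃′ x A _)  = ∀ d → Sat R false (e [ x ↦ d ]) A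

record AgreeOn {S} {D : Set} (A : Formula S) (e e′ : Term S → D) : Set where
  field
    vars : ∀ {x} → Free x A → e (var x) ≡ e′ (var x)
    cons : ∀ {c} → Occurs c A → e (con c) ≡ e′ (con c)

open AgreeOn

module _ {S : Signature} {D : Set} where

  AgreeOn-⊆ : ∀ {A B} {e e′ : Term S → D} →
              (∀ {x} → Free x A → Free x B) → (∀ {c} → Occurs c A → Occurs c B) →
              AgreeOn B e e′ → AgreeOn A e e′
  AgreeOn-⊆ f o ag = record { vars = vars ag ∘ f ; cons = cons ag ∘ o }

  AgreeOn-↦ : ∀ {A x d} {e e′ : Term S → D} →
              (∀ {y} → y ≢ x → Free y A → e (var y) ≡ e′ (var y)) →
              (∀ {c} → Occurs c A → e (con c) ≡ e′ (con c)) →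
              AgreeOn A (e [ x ↦ d ]) (e′ [ x ↦ d ])
  AgreeOn-↦ {A} {x} {d} {e} {e′} v c = record { vars = λ {y} → go y ; cons = c }
    where
    go : ∀ y → Free y A → (e [ x ↦ d ]) (var y) ≡ (e′ [ x ↦ d ]) (var y)
    go y f with x ≟ y
    ... | yes _  = refl
    ... | no x≢y = v (≢-sym x≢y) f

  AgreeOn-atom : ∀ {n} {P : Letter S n} (ts : Vec (Term S) n) {e e′ : Term S → D} →
                 AgreeOn (atom P ts) e e′ → Vec.map e ts ≡ Vec.map e′ ts
  AgreeOn-atom {P = P} ts {e} {e′} ag = go ts id
    where
    go : ∀ {m} (us : Vec (Term S) m) → (∀ {t} → t Vec∈.∈ us → t Vec∈.∈ ts) →
         Vec.map e us ≡ Vec.map e′ us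
    go []           us⊆ts = refl
    go (var _ ∷ us) us⊆ts =
      cong₂ _∷_ (vars ag (us⊆ts (VecAny.here refl))) (go us (us⊆ts ∘ VecAny.there))
    go (con _ ∷ us) us⊆ts =
      cong₂ _∷_ (cons ag (us⊆ts (VecAny.here refl))) (go us (us⊆ts ∘ VecAny.there))

  AgreeOn-sym : ∀ {A} {e e′ : Term S → D} → AgreeOn A e e′ → AgreeOn A e′ e
  AgreeOn-sym ag = record { vars = sym ∘ vars ag ; cons = sym ∘ cons ag }

module _ {S : Signature} {D : Set} {e e′ : Term S → D} where

  [/]-↦ : ∀ {c x y d} → x ≢ y → (∀ t → e′ t ≡ e (t [ c / x ]ᵗ)) →
          ∀ t → (e′ [ y ↦ d ]) t ≡ (e [ y ↦ d ]) (t [ c / x ]ᵗ)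
  [/]-↦ x≢y eq (con c) = eq (con c)
  [/]-↦ {x = x} {y} x≢y eq (var z) with x ≟ z | eq (var z)
  [/]-↦ {x = x} {y} x≢y eq (var z) | yes refl | eq-z with y ≟ x
  ... | yes refl = contradiction refl x≢y
  ... | no  _    = eq-z
  [/]-↦ {x = x} {y} x≢y eq (var z) | no _ | eq-z with y ≟ z
  ... | yes _ = refl
  ... | no  _ = eq-z

rename-eval-↦ : ∀ {S D C} {inf : Infinite C} {f : Const S → C}
                {e : Term (S ⟨ C , inf ⟩) → D} {e′ : Term S → D} {x d} →
                (∀ t → e′ t ≡ e (renameᵗ f t)) →
                ∀ t → (e′ [ x ↦ d ]) t ≡ (e [ x ↦ d ]) (renameᵗ f t)
rename-eval-↦ eq (con c) = eq (con c)
rename-eval-↦ {x = x} eq (var y) with x ≟ y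
... | yes _ = refl
... | no  _ = eq (var y)

module _ {S : Signature} {D : Set} {R : Relations S D} where

  Sat-cong : ∀ b (A : Formula S) {e e′} → AgreeOn A e e′ → Sat R b e A → Sat R b e′ A
  Sat-cong b (atom P ts) ag = subst (_∈ R b P) (AgreeOn-atom ts ag)
  Sat-cong b (¬′ A) ag = Sat-cong (not b) A (AgreeOn-⊆ id id ag)
  Sat-cong true (A ∧′ B) ag (p , q) =
    Sat-cong true A (AgreeOn-⊆ inj₁ inj₁ ag) p , Sat-cong true B (AgreeOn-⊆ inj₂ inj₂ ag) q
  Sat-cong false (A ∧′ B) ag =
    Sum.map (Sat-cong false A (AgreeOn-⊆ inj₁ inj₁ ag)) (Sat-cong false B (AgreeOn-⊆ inj₂ inj₂ ag))
  Sat-cong true (A ∨′ B) ag =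
    Sum.map (Sat-cong true A (AgreeOn-⊆ inj₁ inj₁ ag)) (Sat-cong true B (AgreeOn-⊆ inj₂ inj₂ ag))
  Sat-cong false (A ∨′ B) ag (p , q) =
    Sat-cong false A (AgreeOn-⊆ inj₁ inj₁ ag) p , Sat-cong false B (AgreeOn-⊆ inj₂ inj₂ ag) q
  Sat-cong true (∀′ x A _) ag h d =
    Sat-cong true A (AgreeOn-↦ (λ y≢x f → vars ag (y≢x , f)) (cons ag)) (h d)
  Sat-cong false (∀′ x A _) ag (d , h) =
    d , Sat-cong false A (AgreeOn-↦ (λ y≢x f → vars ag (y≢x , f)) (cons ag)) h
  Sat-cong true (∃′ x A _) ag (d , h) =
    d , Sat-cong true A (AgreeOn-↦ (λ y≢x f → vars ag (y≢x , f)) (cons ag)) h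
  Sat-cong false (∃′ x A _) ag h d =
    Sat-cong false A (AgreeOn-↦ (λ y≢x f → vars ag (y≢x , f)) (cons ag)) (h d)

  Sat-cong-⇔ : ∀ b (A : Formula S) {e e′} → AgreeOn A e e′ → Sat R b e A ⇔ Sat R b e′ A
  Sat-cong-⇔ b A ag = mk⇔ (Sat-cong b A ag) (Sat-cong b A (AgreeOn-sym ag))

  ≡⇒⇔ : {P Q : Set} → P ≡ Q → P ⇔ Q
  ≡⇒⇔ refl = ⇔-id _

  -- The evaluation `e′` is given by a pointwise equation instead of as a composite, because an
  -- updated composite and a composite of the update are only pointwise equal under a quantifier.
  Sat-[/] : ∀ b (A : Formula S) {c x e e′} → (∀ t → e′ t ≡ e (t [ c / x ]ᵗ)) →
            Sat R b e (A [ c / x ]) ⇔ Sat R b e′ A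
  Sat-[/] b (atom P ts) {c} {x} {e} {e′} eq = ≡⇒⇔ (cong (R b P)
    (trans (sym (Vec.map-∘ e _ ts)) (Vec.map-cong (sym ∘ eq) ts)))
  Sat-[/] b     (¬′ A)   eq = Sat-[/] (not b) A eq
  Sat-[/] true  (A ∧′ B) eq = Sat-[/] true A eq ×-⇔ Sat-[/] true B eq
  Sat-[/] false (A ∧′ B) eq = Sat-[/] false A eq ⊎-⇔ Sat-[/] false B eq
  Sat-[/] true  (A ∨′ B) eq = Sat-[/] true A eq ⊎-⇔ Sat-[/] true B eq
  Sat-[/] false (A ∨′ B) eq = Sat-[/] false A eq ×-⇔ Sat-[/] false B eq
  Sat-[/] b (∀′ y A p) {c} {x} {e} {e′} eq with x ≟ y
  -- The quantifier binds `x`, so the substitution stops here and `e` and `e′` need only agree away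
  -- from `x`.
  ... | yes refl = Sat-cong-⇔ b (∀′ x A p) record { vars = go ; cons = λ {c} _ → sym (eq (con c)) }
    where
    go : ∀ {z} → z ≢ x × Free z A → e (var z) ≡ e′ (var z)
    go {z} (z≢x , _) = trans (cong e (sym (var-[/]ᵗ z≢x))) (sym (eq (var z)))
  ... | no x≢y with b
  ...   | true  = Π-⇔ λ d → Sat-[/] true A ([/]-↦ x≢y eq)
  ...   | false = ∃-⇔ λ d → Sat-[/] false A ([/]-↦ x≢y eq)
  Sat-[/] b (∃′ y A p) {c} {x} {e} {e′} eq with x ≟ y
  ... | yes refl = Sat-cong-⇔ b (∃′ x A p) record { vars = go ; cons = λ {c} _ → sym (eq (con c)) }
    where
    go : ∀ {z} → z ≢ x × Free z A → e (var z) ≡ e′ (var z)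
    go {z} (z≢x , _) = trans (cong e (sym (var-[/]ᵗ z≢x))) (sym (eq (var z)))
  ... | no x≢y with b
  ...   | true  = ∃-⇔ λ d → Sat-[/] true A ([/]-↦ x≢y eq)
  ...   | false = Π-⇔ λ d → Sat-[/] false A ([/]-↦ x≢y eq)

  Sat-rename : ∀ {C} {inf : Infinite C} b (A : Formula S) {f : Const S → C} {e e′} →
               (∀ t → e′ t ≡ e (renameᵗ {inf = inf} f t)) →
               Sat R b e (rename f A) ⇔ Sat R b e′ A
  Sat-rename b (atom P ts) {e = e} eq = ≡⇒⇔ (cong (R b P)
    (trans (sym (Vec.map-∘ e _ ts)) (Vec.map-cong (sym ∘ eq) ts)))
  Sat-rename b     (¬′ A)     eq = Sat-rename (not b) A eq
  Sat-rename true  (A ∧′ B)   eq = Sat-rename true A eq ×-⇔ Sat-rename true B eq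
  Sat-rename false (A ∧′ B)   eq = Sat-rename false A eq ⊎-⇔ Sat-rename false B eq
  Sat-rename true  (A ∨′ B)   eq = Sat-rename true A eq ⊎-⇔ Sat-rename true B eq
  Sat-rename false (A ∨′ B)   eq = Sat-rename false A eq ×-⇔ Sat-rename false B eq
  Sat-rename true  (∀′ x A _) {e = e} eq = Π-⇔ λ d → Sat-rename true A (rename-eval-↦ {e = e} eq)
  Sat-rename false (∀′ x A _) {e = e} eq = ∃-⇔ λ d → Sat-rename false A (rename-eval-↦ {e = e} eq)
  Sat-rename true  (∃′ x A _) {e = e} eq = ∃-⇔ λ d → Sat-rename true A (rename-eval-↦ {e = e} eq)
  Sat-rename false (∃′ x A _) {e = e} eq = Π-⇔ λ d → Sat-rename false A (rename-eval-↦ {e = e} eq)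

-- The truth lemma

signed : ∀ {S} → Bool → Formula S → Formula S
signed true  A = A
signed false A = ¬′ A

-- The measure for the truth lemma: an instance `A [ c / x ]` is not a subterm of the quantified
-- formula, but it has the depth of `A`.
depth : ∀ {S} → Formula S → ℕ
depth (atom P ts) = zero
depth (¬′ A)      = suc (depth A)
depth (A ∧′ B)    = suc (depth A ⊔ depth B)
depth (A ∨′ B)    = suc (depth A ⊔ depth B)
depth (∀′ _ A _)  = suc (depth A)
depth (∃′ _ A _)  = suc (depth A)

depth-[/] : ∀ {S} (A : Formula S) {c x} → depth (A [ c / x ]) ≡ depth A
depth-[/] (atom P ts) = refl
depth-[/] (¬′ A)      = cong suc (depth-[/] A)
depth-[/] (A ∧′ B)    = cong₂ (λ m n → suc (m ⊔ n)) (depth-[/] A) (depth-[/] B)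
depth-[/] (A ∨′ B)    = cong₂ (λ m n → suc (m ⊔ n)) (depth-[/] A) (depth-[/] B)
depth-[/] (∀′ y A _) {x = x} with x ≟ y
... | yes _ = refl
... | no  _ = cong suc (depth-[/] A)
depth-[/] (∃′ y A _) {x = x} with x ≟ y
... | yes _ = refl
... | no  _ = cong suc (depth-[/] A)

-- The clauses for v_𝔄, with names nm d for the elements d of the domain.
record Valuation {S D} (R : Relations S D) (e : Term S → D)
                 (V : Pred (Formula S) 0ℓ) : Set where
  field
    nm     : D → Const S
    e-nm   : ∀ d → e (con (nm d)) ≡ d
    V-atom : ∀ b {n} (P : Letter S n) ts → atom P ts ∈ Sent S →
             signed b (atom P ts) ∈ V ⇔ Sat R b e (atom P ts)
    V-∧    : ∀ {A B} → (A ∧′ B) ∈ Sent S → (A ∧′ B) ∈ V ⇔ (A ∈ V × B ∈ V)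
    V-¬∧   : ∀ {A B} → (A ∧′ B) ∈ Sent S → (¬′ (A ∧′ B)) ∈ V ⇔ (¬′ A ∈ V ⊎ ¬′ B ∈ V)
    V-∨    : ∀ {A B} → (A ∨′ B) ∈ Sent S → (A ∨′ B) ∈ V ⇔ (A ∈ V ⊎ B ∈ V)
    V-¬∨   : ∀ {A B} → (A ∨′ B) ∈ Sent S → (¬′ (A ∨′ B)) ∈ V ⇔ (¬′ A ∈ V × ¬′ B ∈ V)
    V-¬¬   : ∀ {A} → A ∈ Sent S → (¬′ ¬′ A) ∈ V ⇔ A ∈ V
    V-∀    : ∀ {x A} .{p : Free x A} → ∀′ x A p ∈ Sent S →
             ∀′ x A p ∈ V ⇔ (∀ d → A [ nm d / x ] ∈ V)
    V-¬∀   : ∀ {x A} .{p : Free x A} → ∀′ x A p ∈ Sent S →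
             (¬′ ∀′ x A p) ∈ V ⇔ (∃[ d ] (¬′ (A [ nm d / x ])) ∈ V)
    V-∃    : ∀ {x A} .{p : Free x A} → ∃′ x A p ∈ Sent S →
             ∃′ x A p ∈ V ⇔ (∃[ d ] A [ nm d / x ] ∈ V)
    V-¬∃   : ∀ {x A} .{p : Free x A} → ∃′ x A p ∈ Sent S →
             (¬′ ∃′ x A p) ∈ V ⇔ (∀ d → (¬′ (A [ nm d / x ])) ∈ V)

module Truth {S : Signature} {D : Set} {R : Relations S D} {e : Term S → D}
  {V : Pred (Formula S) 0ℓ} (val : Valuation {S} {D} R e V) where
  open Valuation val

  e-[/] : ∀ x d t → (e [ x ↦ d ]) t ≡ e (t [ nm d / x ]ᵗ)
  e-[/] x d (con c) = refl
  e-[/] x d (var y) with x ≟ y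
  ... | yes _ = sym (e-nm d)
  ... | no  _ = refl

  -- Both signs are treated at once, since a negation passes from one to the other; the bound `n`
  -- decreases even when `A` is replaced by an instance.
  truth-≤ : ∀ n b A → depth A ≤ n → A ∈ Sent S → signed b A ∈ V ⇔ Sat R b e A

  truth-inst : ∀ n b x A → depth A ≤ n → (∀ y → y ≢ x → ¬ Free y A) → ∀ d →
               signed b (A [ nm d / x ]) ∈ V ⇔ Sat R b (e [ x ↦ d ]) A
  truth-inst n b x A le s d = Sat-[/] b A (e-[/] x d) ⇔-∘
    truth-≤ n b (A [ nm d / x ]) (subst (_≤ n) (sym (depth-[/] A)) le) (Sent-[/] A s (nm d))

  truth-≤ n b (atom P ts) le s = V-atom b P ts s
  truth-≤ (suc n) true  (¬′ A) (s≤s le) s = truth-≤ n false A le s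
  truth-≤ (suc n) false (¬′ A) (s≤s le) s = truth-≤ n true A le s ⇔-∘ V-¬¬ s
  truth-≤ (suc n) true  (A ∧′ B) (s≤s le) s =
    (truth-≤ n true A (m⊔n≤o⇒m≤o _ _ le) (λ x → s x ∘ inj₁) ×-⇔
     truth-≤ n true B (m⊔n≤o⇒n≤o _ _ le) (λ x → s x ∘ inj₂)) ⇔-∘ V-∧ s
  truth-≤ (suc n) false (A ∧′ B) (s≤s le) s =
    (truth-≤ n false A (m⊔n≤o⇒m≤o _ _ le) (λ x → s x ∘ inj₁) ⊎-⇔
     truth-≤ n false B (m⊔n≤o⇒n≤o _ _ le) (λ x → s x ∘ inj₂)) ⇔-∘ V-¬∧ s
  truth-≤ (suc n) true  (A ∨′ B) (s≤s le) s =
    (truth-≤ n true A (m⊔n≤o⇒m≤o _ _ le) (λ x → s x ∘ inj₁) ⊎-⇔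
     truth-≤ n true B (m⊔n≤o⇒n≤o _ _ le) (λ x → s x ∘ inj₂)) ⇔-∘ V-∨ s
  truth-≤ (suc n) false (A ∨′ B) (s≤s le) s =
    (truth-≤ n false A (m⊔n≤o⇒m≤o _ _ le) (λ x → s x ∘ inj₁) ×-⇔
     truth-≤ n false B (m⊔n≤o⇒n≤o _ _ le) (λ x → s x ∘ inj₂)) ⇔-∘ V-¬∨ s
  truth-≤ (suc n) true  (∀′ x A _) (s≤s le) s =
    Π-⇔ (truth-inst n true x A le λ y y≢x f → s y (y≢x , f)) ⇔-∘ V-∀ s
  truth-≤ (suc n) false (∀′ x A _) (s≤s le) s =
    ∃-⇔ (truth-inst n false x A le λ y y≢x f → s y (y≢x , f)) ⇔-∘ V-¬∀ s
  truth-≤ (suc n) true  (∃′ x A _) (s≤s le) s =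
    ∃-⇔ (truth-inst n true x A le λ y y≢x f → s y (y≢x , f)) ⇔-∘ V-∃ s
  truth-≤ (suc n) false (∃′ x A _) (s≤s le) s =
    Π-⇔ (truth-inst n false x A le λ y y≢x f → s y (y≢x , f)) ⇔-∘ V-¬∃ s

  -- Used twice: for the valuation induced by a structure, and for the prime Henkin theory over its
  -- term model.
  truth : ∀ A → A ∈ Sent S → A ∈ V ⇔ Sat R true e A
  truth A = truth-≤ (depth A) true A ≤-refl

-- The valuation induced by a structure

closed-terms : ∀ {S n} (ts : Vec (Term S) n) → (∀ x → ¬ var x Vec∈.∈ ts) →
               ∃[ cs ] ts ≡ Vec.map con cs
closed-terms []           closed = [] , refl
closed-terms (var x ∷ ts) closed = contradiction (VecAny.here refl) (closed x)
closed-terms (con c ∷ ts) closed =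
  let cs , eq = closed-terms ts (λ x → closed x ∘ VecAny.there) in c ∷ cs , cong (con c ∷_) eq

module _ {S : Signature} (𝔄 : Structure S) where
  private module 𝔄 = Structure 𝔄

  relations : Relations S 𝔄.Domain
  relations true  P = P 𝔄.⁺
  relations false P = P 𝔄.⁻

  -- The value at variables is a default; the truth of a sentence does not depend on it.
  eval : Term S → 𝔄.Domain
  eval (var x) = 𝔄.nonempty
  eval (con c) = 𝔄.⟦ c ⟧

module _ {S : Signature} (𝔄 : Structure S) where
  private
    module 𝔄 = Structure 𝔄
    v : Pred (Formula (diagram 𝔄)) 0ℓ
    v A = v⟨ 𝔄 ⟩ A ≡1

  v-atom : ∀ b {n} (P : Letter S n) ts → atom P ts ∈ Sent (diagram 𝔄) →
           signed b (atom P ts) ∈ v ⇔ Sat (relations 𝔄) b (eval (hat 𝔄)) (atom P ts)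
  v-atom true P ts s = mk⇔
    (λ { (atom⁺ cs h) → subst (_∈ (P 𝔄.⁺)) (Vec.map-∘ (eval (hat 𝔄)) con cs) h }) back
    where
    back : Vec.map (eval (hat 𝔄)) ts ∈ (P 𝔄.⁺) → v⟨ 𝔄 ⟩ atom P ts ≡1
    back h with closed-terms ts s
    ... | cs , refl = atom⁺ cs (subst (_∈ (P 𝔄.⁺)) (sym (Vec.map-∘ (eval (hat 𝔄)) con cs)) h)
  v-atom false P ts s = mk⇔
    (λ { (atom⁻ cs h) → subst (_∈ (P 𝔄.⁻)) (Vec.map-∘ (eval (hat 𝔄)) con cs) h }) back
    where
    back : Vec.map (eval (hat 𝔄)) ts ∈ (P 𝔄.⁻) → v⟨ 𝔄 ⟩ ¬′ atom P ts ≡1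
    back h with closed-terms ts s
    ... | cs , refl = atom⁻ cs (subst (_∈ (P 𝔄.⁻)) (sym (Vec.map-∘ (eval (hat 𝔄)) con cs)) h)

  v-Valuation : Valuation (relations 𝔄) (eval (hat 𝔄)) v
  v-Valuation = record
    { nm     = name 𝔄
    ; e-nm   = λ _ → refl
    ; V-atom = v-atom
    ; V-∧    = λ _ → mk⇔ (λ { (and h) → h }) and
    ; V-¬∧   = λ _ → mk⇔ (λ { (¬and h) → h }) ¬and
    ; V-∨    = λ _ → mk⇔ (λ { (or h) → h }) or
    ; V-¬∨   = λ _ → mk⇔ (λ { (¬or h) → h }) ¬or
    ; V-¬¬   = λ _ → mk⇔ (λ { (¬¬ h) → h }) ¬¬
    ; V-∀    = λ _ → mk⇔ (λ { (all h) → h }) all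
    ; V-¬∀   = λ _ → mk⇔ (λ { (¬all h) → h }) ¬all
    ; V-∃    = λ _ → mk⇔ (λ { (ex h) → h }) ex
    ; V-¬∃   = λ _ → mk⇔ (λ { (¬ex h) → h }) ¬ex
    }

  lift≡rename : ∀ A → lift 𝔄 A ≡ rename inj₁ A
  lift≡rename (atom P ts) = cong (atom P) (Vec.map-cong (λ { (var _) → refl ; (con _) → refl }) ts)
  lift≡rename (¬′ A)      = cong ¬′_ (lift≡rename A)
  lift≡rename (A ∧′ B)    = cong₂ _∧′_ (lift≡rename A) (lift≡rename B)
  lift≡rename (A ∨′ B)    = cong₂ _∨′_ (lift≡rename A) (lift≡rename B)
  lift≡rename (∀′ x A _)  = ∀′-cong (lift≡rename A)
  lift≡rename (∃′ x A _)  = ∃′-cong (lift≡rename A)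

  -- The truth lemma speaks of the diagram signature; since `lift` is the renaming along `inj₁`,
  -- satisfaction there is satisfaction over `S`.
  v-lift⇔Sat : ∀ A → A ∈ Sent S → v⟨ 𝔄 ⟩ lift 𝔄 A ≡1 ⇔ Sat (relations 𝔄) true (eval 𝔄) A
  v-lift⇔Sat A s rewrite lift≡rename A =
    Sat-rename true A (λ { (var _) → refl ; (con _) → refl }) ⇔-∘
    Truth.truth v-Valuation (rename inj₁ A) (Sent-rename inj₁ A s)

-- Soundness

Discharge-All : ∀ {S} {P : Pred (Formula S) 0ℓ} {A Δ Δ′} →
                Discharge A Δ Δ′ → P A → All P Δ′ → All P Δ
Discharge-All done     pA []       = []
Discharge-All (keep d) pA (p ∷ ps) = p ∷ Discharge-All d pA ps
Discharge-All (drop d) pA ps       = pA ∷ Discharge-All d pA ps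

module Soundness (em : ExcludedMiddle 0ℓ) {S : Signature} {D : Set} (R : Relations S D)
  (≈⇔≡ : ∀ {a b} → (a ∷ b ∷ []) ∈ R true (≈ S) ⇔ a ≡ b) where
  open RenameDerivation em

  private
    ⟦_⟧_ : Formula S → (Term S → D) → Set
    ⟦ A ⟧ e = Sat R true e A

  AgreeOn-eigen : ∀ {A : Formula S} {e : Term S → D} {c d} → ¬ Occurs c A →
                  AgreeOn A e (e [ con c ↦ d ]ᶜ)
  AgreeOn-eigen {e = e} c∉A = record
    { vars = λ _ → sym (↦-miss e λ ())
    ; cons = λ o → sym (↦-miss e λ { refl → c∉A o })
    }

  All-eigen : ∀ {e : Term S → D} {c d Δ} → All (λ H → ¬ Occurs c H) Δ →
              All (⟦_⟧ e) Δ → All (⟦_⟧ (e [ con c ↦ d ]ᶜ)) Δ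
  All-eigen c∉Δ h = All.zipWith (λ {H} (c∉H , p) → Sat-cong true H (AgreeOn-eigen c∉H) p) (c∉Δ , h)

  [/]-eval : ∀ {e : Term S → D} c x t → (e [ x ↦ e (con c) ]) t ≡ e (t [ c / x ]ᵗ)
  [/]-eval c x (con _) = refl
  [/]-eval c x (var y) with x ≟ y
  ... | yes _ = refl
  ... | no  _ = refl

  Sat-inst : ∀ b A {c x} {e : Term S → D} →
             Sat R b e (A [ c / x ]) ⇔ Sat R b (e [ x ↦ e (con c) ]) A
  Sat-inst b A {c} {x} = Sat-[/] b A ([/]-eval c x)

  -- As `c` is absent from `A`, reinterpreting it is felt only where it was substituted for `x`.
  Sat-eigen : ∀ b A {c x d} {e : Term S → D} → ¬ Occurs c A →
              Sat R b (e [ con c ↦ d ]ᶜ) (A [ c / x ]) ⇔ Sat R b (e [ x ↦ d ]) A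
  Sat-eigen b A {c} {x} {d} {e} c∉A = Sat-cong-⇔ b A agree ⇔-∘ Sat-inst b A
    where
    e′ = e [ con c ↦ d ]ᶜ

    vars-agree : ∀ y → (e′ [ x ↦ e′ (con c) ]) (var y) ≡ (e [ x ↦ d ]) (var y)
    vars-agree y with x ≟ y
    ... | yes _ = ↦-hit e (con c)
    ... | no  _ = ↦-miss e λ ()

    agree : AgreeOn A (e′ [ x ↦ e′ (con c) ]) (e [ x ↦ d ])
    agree = record
      { vars = λ {y} _ → vars-agree y
      ; cons = λ o → ↦-miss e λ { refl → c∉A o }
      }

  -- The induction is over all evaluations `e`, because rules with an eigenconstant use the premise
  -- at evaluations that differ from `e` at that constant. Evaluations cover constants as well as
  -- variables, so no structure has to be changed.
  sound : ∀ {Δ A} → Derivation Δ A → ∀ e → All (⟦_⟧ e) Δ → ⟦ A ⟧ e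

  -- The common core of `∃E` and `¬∀E`: the element `d` becomes the value of `c`, which neither `C`
  -- nor the remaining hypotheses can notice.
  sound-eigen : ∀ {Δ Δ′ B C c} → ¬ Occurs c C → All (λ H → ¬ Occurs c H) Δ′ →
                Derivation Δ C → Discharge B Δ Δ′ → ∀ e d →
                ⟦ B ⟧ (e [ con c ↦ d ]ᶜ) → All (⟦_⟧ e) Δ′ → ⟦ C ⟧ e
  sound-eigen {C = C} c∉C c∉Δ D dis e d b h =
    Sat-cong true C (AgreeOn-sym (AgreeOn-eigen c∉C))
      (sound D (e [ con _ ↦ d ]ᶜ) (Discharge-All dis b (All-eigen c∉Δ h)))

  sound (hyp s)     e (p ∷ []) = p
  sound (∧I {Δ₁} D₁ D₂) e h = sound D₁ e (All.++⁻ˡ Δ₁ h) , sound D₂ e (All.++⁻ʳ Δ₁ h)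
  sound (∧E₁ D)     e h = proj₁ (sound D e h)
  sound (∧E₂ D)     e h = proj₂ (sound D e h)
  sound (∨I₁ s D)   e h = inj₁ (sound D e h)
  sound (∨I₂ s D)   e h = inj₂ (sound D e h)
  sound (∨E {Δ} {Δ₁′ = Δ₁′} D D₁ d₁ D₂ d₂) e h =
    [ (λ p → sound D₁ e (Discharge-All d₁ p (All.++⁻ˡ Δ₁′ (All.++⁻ʳ Δ h))))
    , (λ p → sound D₂ e (Discharge-All d₂ p (All.++⁻ʳ Δ₁′ (All.++⁻ʳ Δ h)))) ]′
    (sound D e (All.++⁻ˡ Δ h))
  sound (¬∧I₁ s D)  e h = inj₁ (sound D e h)
  sound (¬∧I₂ s D)  e h = inj₂ (sound D e h)
  sound (¬∧E {Δ} {Δ₁′ = Δ₁′} D D₁ d₁ D₂ d₂) e h =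
    [ (λ p → sound D₁ e (Discharge-All d₁ p (All.++⁻ˡ Δ₁′ (All.++⁻ʳ Δ h))))
    , (λ p → sound D₂ e (Discharge-All d₂ p (All.++⁻ʳ Δ₁′ (All.++⁻ʳ Δ h)))) ]′
    (sound D e (All.++⁻ˡ Δ h))
  sound (¬∨I {Δ₁} D₁ D₂) e h = sound D₁ e (All.++⁻ˡ Δ₁ h) , sound D₂ e (All.++⁻ʳ Δ₁ h)
  sound (¬∨E₁ D)    e h = proj₁ (sound D e h)
  sound (¬∨E₂ D)    e h = proj₂ (sound D e h)
  sound (DNI D)     e h = sound D e h
  sound (DNE D)     e h = sound D e h
  -- The side disjunct is decided before `d` varies: its truth does not depend on the value of `c`,
  -- so if it fails at `e` it fails for every `d`.
  sound (∀I {A = A} {B} {x} {c} _ c∉A c∉B c∉Δ D) e h with em {⟦ B ⟧ e}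
  ... | yes b = inj₁ b
  ... | no ¬b = inj₂ λ d →
    [ (λ b → contradiction (Sat-cong true B (AgreeOn-sym (AgreeOn-eigen c∉B)) b) ¬b)
    , to (Sat-eigen true A c∉A) ]′
    (sound D (e [ con c ↦ d ]ᶜ) (All-eigen c∉Δ h))
  sound (∀E {A = A} c D) e h = from (Sat-inst true A) (sound D e h (e (con c)))
  sound (∃I {A = A} {c = c} _ D) e h = e (con c) , to (Sat-inst true A) (sound D e h)
  sound (∃E {Δ₁} {A = A} c∉A c∉C c∉Δ D₁ D₂ dis) e h =
    let d , p = sound D₁ e (All.++⁻ˡ Δ₁ h) in
    sound-eigen c∉C c∉Δ D₂ dis e d (from (Sat-eigen true A c∉A) p) (All.++⁻ʳ Δ₁ h)
  sound (¬∀I {A = A} {c = c} _ D) e h = e (con c) , to (Sat-inst false A) (sound D e h)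
  sound (¬∀E {Δ₁} {A = A} c∉A c∉C c∉Δ D₁ D₂ dis) e h =
    let d , p = sound D₁ e (All.++⁻ˡ Δ₁ h) in
    sound-eigen c∉C c∉Δ D₂ dis e d (from (Sat-eigen false A c∉A) p) (All.++⁻ʳ Δ₁ h)
  sound (¬∃I {A = A} {c = c} _ c∉A c∉Δ D) e h d =
    to (Sat-eigen false A c∉A) (sound D (e [ con c ↦ d ]ᶜ) (All-eigen c∉Δ h))
  sound (¬∃E {A = A} c D) e h = from (Sat-inst false A) (sound D e h (e (con c)))
  sound (≈I c) e h = from ≈⇔≡ refl
  sound (≈E {Δ₁} A x D₁ D₂) e h =
    from (Sat-inst true A)
      (subst (λ d → ⟦ A ⟧ (e [ x ↦ d ])) (to ≈⇔≡ (sound D₁ e (All.++⁻ˡ Δ₁ h)))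
        (to (Sat-inst true A) (sound D₂ e (All.++⁻ʳ Δ₁ h))))

-- Derivability from sets, and Henkin axioms

infixl 5 _▸_

_▸_ : ∀ {S} → Pred (Formula S) 0ℓ → Formula S → Pred (Formula S) 0ℓ
Θ ▸ A = Θ ∪ ｛ A ｝

FreshFor : ∀ {S} → Const S → Pred (Formula S) 0ℓ → Set
FreshFor c Θ = ∀ B → B ∈ Θ → ¬ Occurs c B

module _ {S : Signature} where

  ▸-fresh : ∀ {Θ : Pred (Formula S) 0ℓ} {A c} → FreshFor c Θ → ¬ Occurs c A → FreshFor c (Θ ▸ A)
  ▸-fresh c∉Θ c∉A B (inj₁ B∈Θ)  = c∉Θ B B∈Θ
  ▸-fresh c∉Θ c∉A B (inj₂ refl) = c∉A

  -- The membership proofs tell which leaves to discharge, so formulas need not be compared.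
  discharge : ∀ {Θ : Pred (Formula S) 0ℓ} {A Δ} → All (_∈ Θ ▸ A) Δ →
              ∃[ Δ′ ] (Discharge A Δ Δ′ × All (_∈ Θ) Δ′)
  discharge [] = [] , done , []
  discharge (inj₁ B∈Θ ∷ Δ⊆) =
    let Δ′ , dis , Δ′⊆ = discharge Δ⊆ in _ ∷ Δ′ , keep dis , B∈Θ ∷ Δ′⊆
  discharge (inj₂ refl ∷ Δ⊆) =
    let Δ′ , dis , Δ′⊆ = discharge Δ⊆ in Δ′ , drop dis , Δ′⊆

  ⊢-hyp : ∀ {Θ : Pred (Formula S) 0ℓ} {A} → A ∈ Sent S → A ∈ Θ → Θ ⊢ A
  ⊢-hyp s A∈Θ = _ , A∈Θ ∷ [] , hyp s

  ⊢-mono : ∀ {Θ Ξ : Pred (Formula S) 0ℓ} {A} → Θ ⊆ Ξ → Θ ⊢ A → Ξ ⊢ A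
  ⊢-mono Θ⊆Ξ (Δ , Δ⊆Θ , D) = Δ , All.map Θ⊆Ξ Δ⊆Θ , D

  ⊢-weaken : ∀ {Θ : Pred (Formula S) 0ℓ} {A B C} → Θ ▸ A ⊢ C → Θ ▸ B ▸ A ⊢ C
  ⊢-weaken = ⊢-mono λ { (inj₁ D∈Θ) → inj₁ (inj₁ D∈Θ) ; (inj₂ A≡D) → inj₂ A≡D }

  ⊢-rule : ∀ {Θ : Pred (Formula S) 0ℓ} {A B} →
           (∀ {Δ} → Derivation Δ A → Derivation Δ B) → Θ ⊢ A → Θ ⊢ B
  ⊢-rule r (Δ , Δ⊆Θ , D) = Δ , Δ⊆Θ , r D

  ⊢-∨E : ∀ {Θ : Pred (Formula S) 0ℓ} {A B C} → Θ ⊢ A ∨′ B → Θ ▸ A ⊢ C → Θ ▸ B ⊢ C → Θ ⊢ C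
  ⊢-∨E (Δ , Δ⊆ , D) (Δ₁ , Δ₁⊆ , D₁) (Δ₂ , Δ₂⊆ , D₂) =
    let Δ₁′ , dis₁ , Δ₁′⊆ = discharge Δ₁⊆
        Δ₂′ , dis₂ , Δ₂′⊆ = discharge Δ₂⊆
    in Δ ++ Δ₁′ ++ Δ₂′ , All.++⁺ Δ⊆ (All.++⁺ Δ₁′⊆ Δ₂′⊆) , ∨E D D₁ dis₁ D₂ dis₂

  -- In place of an implication, `A` is weakened to `A ∨′ A` and eliminated by the same derivation
  -- twice.
  ⊢-cut : ∀ {Θ : Pred (Formula S) 0ℓ} {A C} → A ∈ Sent S → Θ ⊢ A → Θ ▸ A ⊢ C → Θ ⊢ C
  ⊢-cut s ⊢A A⊢C = ⊢-∨E (⊢-rule (∨I₁ s) ⊢A) A⊢C A⊢C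

  ⊢-∃E : ∀ {Θ : Pred (Formula S) 0ℓ} {x A C c} .{p : Free x A} →
         FreshFor c Θ → ¬ Occurs c A → ¬ Occurs c C →
         Θ ⊢ ∃′ x A p → Θ ▸ A [ c / x ] ⊢ C → Θ ⊢ C
  ⊢-∃E c∉Θ c∉A c∉C (Δ₁ , Δ₁⊆ , D₁) (Δ₂ , Δ₂⊆ , D₂) =
    let Δ₂′ , dis , Δ₂′⊆ = discharge Δ₂⊆ in
    Δ₁ ++ Δ₂′ , All.++⁺ Δ₁⊆ Δ₂′⊆ , ∃E c∉A c∉C (All.map (c∉Θ _) Δ₂′⊆) D₁ D₂ dis

  ⊢-¬∀E : ∀ {Θ : Pred (Formula S) 0ℓ} {x A C c} .{p : Free x A} →
          FreshFor c Θ → ¬ Occurs c A → ¬ Occurs c C →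
          Θ ⊢ ¬′ ∀′ x A p → Θ ▸ ¬′ (A [ c / x ]) ⊢ C → Θ ⊢ C
  ⊢-¬∀E c∉Θ c∉A c∉C (Δ₁ , Δ₁⊆ , D₁) (Δ₂ , Δ₂⊆ , D₂) =
    let Δ₂′ , dis , Δ₂′⊆ = discharge Δ₂⊆ in
    Δ₁ ++ Δ₂′ , All.++⁺ Δ₁⊆ Δ₂′⊆ , ¬∀E c∉A c∉C (All.map (c∉Θ _) Δ₂′⊆) D₁ D₂ dis

  ⊢-∀I : ∀ {Θ : Pred (Formula S) 0ℓ} {x A B c} .(p : Free x A) →
         FreshFor c Θ → ¬ Occurs c A → ¬ Occurs c B →
         Θ ⊢ B ∨′ A [ c / x ] → Θ ⊢ B ∨′ ∀′ x A p
  ⊢-∀I p c∉Θ c∉A c∉B (Δ , Δ⊆ , D) = Δ , Δ⊆ , ∀I p c∉A c∉B (All.map (c∉Θ _) Δ⊆) D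

  -- Axiom c A P Q: the Henkin axiom with witness c for the quantified
  -- sentence A is the entailment from P to Q.
  data Axiom (c : Const S) : (A P Q : Formula S) → Set where
    ∃-axiom  : ∀ {x A} .{p : Free x A} → Axiom c (∃′ x A p) (∃′ x A p) (A [ c / x ])
    ¬∀-axiom : ∀ {x A} .{p : Free x A} →
               Axiom c (¬′ ∀′ x A p) (¬′ ∀′ x A p) (¬′ (A [ c / x ]))
    ∀-axiom  : ∀ {x A} .{p : Free x A} → Axiom c (∀′ x A p) (A [ c / x ]) (∀′ x A p)
    ¬∃-axiom : ∀ {x A} .{p : Free x A} →
               Axiom c (¬′ ∃′ x A p) (¬′ (A [ c / x ])) (¬′ ∃′ x A p)

  Axiom-unique : ∀ {c A P Q P′ Q′} → Axiom c A P Q → Axiom c A P′ Q′ → P ≡ P′ × Q ≡ Q′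
  Axiom-unique ∃-axiom  ∃-axiom  = refl , refl
  Axiom-unique ¬∀-axiom ¬∀-axiom = refl , refl
  Axiom-unique ∀-axiom  ∀-axiom  = refl , refl
  Axiom-unique ¬∃-axiom ¬∃-axiom = refl , refl

  Axiom-Sent : ∀ {c A P Q} → Axiom c A P Q → A ∈ Sent S → P ∈ Sent S × Q ∈ Sent S
  Axiom-Sent (∃-axiom  {A = A}) s = s , Sent-[/] A (λ y y≢x f → s y (y≢x , f)) _
  Axiom-Sent (¬∀-axiom {A = A}) s = s , Sent-[/] A (λ y y≢x f → s y (y≢x , f)) _
  Axiom-Sent (∀-axiom  {A = A}) s = Sent-[/] A (λ y y≢x f → s y (y≢x , f)) _ , s
  Axiom-Sent (¬∃-axiom {A = A}) s = Sent-[/] A (λ y y≢x f → s y (y≢x , f)) _ , s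

  Axiom-fresh : ∀ {c d A P Q} → Axiom c A P Q → ¬ Occurs d A → d ≢ c →
                ¬ Occurs d P × ¬ Occurs d Q
  Axiom-fresh (∃-axiom  {A = A}) d∉A d≢c = d∉A , [ d∉A , d≢c ]′ ∘ Occurs-[/]⁻ A
  Axiom-fresh (¬∀-axiom {A = A}) d∉A d≢c = d∉A , [ d∉A , d≢c ]′ ∘ Occurs-[/]⁻ A
  Axiom-fresh (∀-axiom  {A = A}) d∉A d≢c = [ d∉A , d≢c ]′ ∘ Occurs-[/]⁻ A , d∉A
  Axiom-fresh (¬∃-axiom {A = A}) d∉A d≢c = [ d∉A , d≢c ]′ ∘ Occurs-[/]⁻ A , d∉A

  -- By contraposition, one of the two ways of meeting an axiom leaves `E` underivable. For the two
  -- axioms that lead to an instance, `c` is the eigenconstant of an elimination rule; for the other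
  -- two, `E` is the side disjunct of `∀I`.
  Axiom-elim : ∀ {Θ : Pred (Formula S) 0ℓ} {c A P Q E} → Axiom c A P Q →
               A ∈ Sent S → E ∈ Sent S →
               FreshFor c Θ → ¬ Occurs c A → ¬ Occurs c E →
               Θ ⊢ E ∨′ P → Θ ▸ Q ⊢ E → Θ ⊢ E
  Axiom-elim ∃-axiom sA sE c∉Θ c∉A c∉E ⊢E∨P Q⊢E =
    ⊢-∨E ⊢E∨P (⊢-hyp sE (inj₂ refl))
      (⊢-∃E (▸-fresh c∉Θ c∉A) c∉A c∉E (⊢-hyp sA (inj₂ refl)) (⊢-weaken Q⊢E))
  Axiom-elim ¬∀-axiom sA sE c∉Θ c∉A c∉E ⊢E∨P Q⊢E =
    ⊢-∨E ⊢E∨P (⊢-hyp sE (inj₂ refl))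
      (⊢-¬∀E (▸-fresh c∉Θ c∉A) c∉A c∉E (⊢-hyp sA (inj₂ refl)) (⊢-weaken Q⊢E))
  Axiom-elim (∀-axiom {p = p}) sA sE c∉Θ c∉A c∉E ⊢E∨P Q⊢E =
    ⊢-∨E (⊢-∀I p c∉Θ c∉A c∉E ⊢E∨P) (⊢-hyp sE (inj₂ refl)) Q⊢E
  -- ¬∃I has no side disjunct, so the disjunction passes through ∀x¬A.
  Axiom-elim {c = c} (¬∃-axiom {x} {A} {p = p}) sA sE c∉Θ c∉A c∉E ⊢E∨P Q⊢E =
    ⊢-∨E (⊢-∀I {A = ¬′ A} p c∉Θ c∉A c∉E ⊢E∨P) (⊢-hyp sE (inj₂ refl))
      -- Freeness in `∀′ x (¬′ A) p` and in `¬′ ∃′ x A p` unfolds to the same type, so `sA` serves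
      -- for both.
      (⊢-cut sA
        (∀′ x (¬′ A) p ∷ [] , inj₂ refl ∷ [] ,
         ¬∃I p c∉A (c∉A ∷ []) (∀E c (hyp sA)))
        (⊢-weaken Q⊢E))

-- Witness constants

-- Code S mirrors Formula (Henkin S), which could not occur in the type of the
-- constants of its own signature.
data Code (S : Signature) : Set where
  atom  : ∀ {n} → Letter S n → Vec (Var ⊎ (Const S ⊎ Code S)) n → Code S
  neg   : Code S → Code S
  and or : Code S → Code S → Code S
  all ex : Var → Code S → Code S

Henkin : Signature → Signature
Henkin S = S ⟨ Const S ⊎ Code S , ⊎-infinite (Code S) (infinite S) ⟩

module _ {S : Signature} where

  encodeᵗ : Term (Henkin S) → Var ⊎ (Const S ⊎ Code S)
  encodeᵗ (var x) = inj₁ x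
  encodeᵗ (con c) = inj₂ c

  encode : Formula (Henkin S) → Code S
  encode (atom P ts) = atom P (Vec.map encodeᵗ ts)
  encode (¬′ A)      = neg (encode A)
  encode (A ∧′ B)    = and (encode A) (encode B)
  encode (A ∨′ B)    = or (encode A) (encode B)
  encode (∀′ x A _)  = all x (encode A)
  encode (∃′ x A _)  = ex x (encode A)

  witness : Formula (Henkin S) → Const (Henkin S)
  witness A = inj₂ (encode A)

  -- The nesting depth of witness constants, that is, the stage of an iterated Henkin extension at
  -- which the sentence becomes expressible.
  rank : Code S → ℕ
  ranks : ∀ {n} → Vec (Var ⊎ (Const S ⊎ Code S)) n → ℕ
  rank (atom P ts) = ranks ts
  rank (neg k)     = rank k
  rank (and k l)   = rank k ⊔ rank l
  rank (or k l)    = rank k ⊔ rank l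
  rank (all x k)   = rank k
  rank (ex x k)    = rank k
  ranks []                   = zero
  ranks (inj₁ x ∷ ts)        = ranks ts
  ranks (inj₂ (inj₁ c) ∷ ts) = ranks ts
  ranks (inj₂ (inj₂ k) ∷ ts) = suc (rank k) ⊔ ranks ts

  rank-Occurs : ∀ A {k} → Occurs (inj₂ k) A → suc (rank k) ≤ rank (encode A)
  rank-Occurs (atom P ts) = go ts
    where
    go : ∀ {n k} (ts : Vec (Term (Henkin S)) n) → con (inj₂ k) Vec∈.∈ ts →
         suc (rank k) ≤ ranks (Vec.map encodeᵗ ts)
    go (var x ∷ ts)        (VecAny.there p)   = go ts p
    go (con (inj₁ c) ∷ ts) (VecAny.there p)   = go ts p
    go (con (inj₂ k) ∷ ts) (VecAny.here refl) = m≤m⊔n _ (ranks (Vec.map encodeᵗ ts))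
    go (con (inj₂ k) ∷ ts) (VecAny.there p)   = m≤n⇒m≤o⊔n _ (go ts p)
  rank-Occurs (¬′ A)     o        = rank-Occurs A o
  rank-Occurs (A ∧′ B)   (inj₁ o) = m≤n⇒m≤n⊔o _ (rank-Occurs A o)
  rank-Occurs (A ∧′ B)   (inj₂ o) = m≤n⇒m≤o⊔n _ (rank-Occurs B o)
  rank-Occurs (A ∨′ B)   (inj₁ o) = m≤n⇒m≤n⊔o _ (rank-Occurs A o)
  rank-Occurs (A ∨′ B)   (inj₂ o) = m≤n⇒m≤o⊔n _ (rank-Occurs B o)
  rank-Occurs (∀′ x A _) o        = rank-Occurs A o
  rank-Occurs (∃′ x A _) o        = rank-Occurs A o

  -- Every code that occurs as a constant in `A` has smaller rank than `A`. In particular no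
  -- sentence contains its own witness.
  witness-∉ : ∀ {A B} → rank (encode A) ≤ rank (encode B) → ¬ Occurs (witness B) A
  witness-∉ {A} le o = 1+n≰n (≤-trans (rank-Occurs A o) le)

  module Decode (em : ExcludedMiddle 0ℓ) where

    decodeᵗ : Var ⊎ (Const S ⊎ Code S) → Term (Henkin S)
    decodeᵗ (inj₁ x) = var x
    decodeᵗ (inj₂ c) = con c

    -- A left inverse of `encode`, for the sake of injectivity. A code with a void quantifier
    -- encodes no formula, and dropping the quantifier is an arbitrary value.
    decode : Code S → Formula (Henkin S)
    decode (atom P ts) = atom P (Vec.map decodeᵗ ts)
    decode (neg k)     = ¬′ decode k
    decode (and k l)   = decode k ∧′ decode l
    decode (or k l)    = decode k ∨′ decode l
    decode (all x k) with em {Free x (decode k)}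
    ... | yes p = ∀′ x (decode k) p
    ... | no  _ = decode k
    decode (ex x k) with em {Free x (decode k)}
    ... | yes p = ∃′ x (decode k) p
    ... | no  _ = decode k

    decode-encode : ∀ A → decode (encode A) ≡ A
    decode-encode (atom P ts) = cong (atom P)
      (trans (sym (Vec.map-∘ _ _ ts))
        (trans (Vec.map-cong (λ { (var _) → refl ; (con _) → refl }) ts) (Vec.map-id ts)))
    decode-encode (¬′ A)     = cong ¬′_ (decode-encode A)
    decode-encode (A ∧′ B)   = cong₂ _∧′_ (decode-encode A) (decode-encode B)
    decode-encode (A ∨′ B)   = cong₂ _∨′_ (decode-encode A) (decode-encode B)
    decode-encode (∀′ x A p) with em {Free x (decode (encode A))}
    ... | yes _ = ∀′-cong (decode-encode A)
    -- The proof `p` is irrelevant, hence available only for a refutation.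
    ... | no ¬q = ⊥-elim-irr (¬q (subst (Free x) (sym (decode-encode A)) p))
    decode-encode (∃′ x A p) with em {Free x (decode (encode A))}
    ... | yes _ = ∃′-cong (decode-encode A)
    ... | no ¬q = ⊥-elim-irr (¬q (subst (Free x) (sym (decode-encode A)) p))

    witness-injective : ∀ {A B} → witness A ≡ witness B → A ≡ B
    witness-injective {A} {B} eq =
      trans (sym (decode-encode A)) (trans (cong decode (inj₂-injective eq)) (decode-encode B))

-- Accepting and rejecting finitely many sentences

module Completeness (em : ExcludedMiddle 0ℓ) (ext : Extensionality 0ℓ 0ℓ) {S : Signature} where
  open Compactness em ext
  open RenameDerivation em
  open Decode {S} em

  private
    H : Signature
    H = Henkin S

  -- The disjuncts of right play the role of the rejected sentences of a
  -- multiple-conclusion sequent.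
  record State : Set₁ where
    field
      left       : Pred (Formula H) 0ℓ
      right      : Formula H
      right-Sent : right ∈ Sent H
      unprovable : ¬ left ⊢ right

  open State

  -- Rejection means entailing `right s`, not being one of its disjuncts, and so persists by cut
  -- whenever `right s` is weakened.
  Accepts Rejects : State → Formula H → Set
  Accepts s A = A ∈ left s
  Rejects s A = ｛ A ｝ ⊢ right s

  infix 4 _≼_

  record _≼_ (s t : State) : Set where
    field
      left-⊆  : left s ⊆ left t
      right-⊢ : ｛ right s ｝ ⊢ right t

  open _≼_

  ≼-refl : ∀ {s} → s ≼ s
  ≼-refl {s} = record { left-⊆ = id ; right-⊢ = ⊢-hyp (right-Sent s) refl }

  Rejects-mono : ∀ {s t A} → s ≼ t → Rejects s A → Rejects t A
  Rejects-mono {s} s≼t r = ⊢-cut (right-Sent s) r (⊢-mono inj₂ (right-⊢ s≼t))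

  ≼-trans : ∀ {s t u} → s ≼ t → t ≼ u → s ≼ u
  ≼-trans s≼t t≼u = record
    { left-⊆ = left-⊆ t≼u ∘ left-⊆ s≼t ; right-⊢ = Rejects-mono t≼u (right-⊢ s≼t) }

  accept : ∀ s A → ¬ left s ▸ A ⊢ right s → State
  accept s A ¬d = record
    { left = left s ▸ A ; right = right s ; right-Sent = right-Sent s ; unprovable = ¬d }

  accept-≽ : ∀ s {A ¬d} → s ≼ accept s A ¬d
  accept-≽ s = record { left-⊆ = inj₁ ; right-⊢ = ⊢-hyp (right-Sent s) refl }

  ∨-Sent : ∀ A B → A ∈ Sent H → B ∈ Sent H → (A ∨′ B) ∈ Sent H
  ∨-Sent A B sA sB x = [ sA x , sB x ]′

  reject : ∀ s A → A ∈ Sent H → ¬ left s ⊢ right s ∨′ A → State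
  reject s A sA ¬d = record
    { left = left s ; right = right s ∨′ A
    ; right-Sent = ∨-Sent (right s) A (right-Sent s) sA ; unprovable = ¬d }

  reject-≽ : ∀ s {A} sA {¬d} → s ≼ reject s A sA ¬d
  reject-≽ s sA = record
    { left-⊆ = id ; right-⊢ = ⊢-rule (∨I₁ sA) (⊢-hyp (right-Sent s) refl) }

  ⊢-right∨ : ∀ s {A} → A ∈ Sent H → ｛ A ｝ ⊢ right s ∨′ A
  ⊢-right∨ s sA = ⊢-rule (∨I₂ (right-Sent s)) (⊢-hyp sA refl)

  -- Ties in rank are allowed, since distinct sentences of equal rank do not contain each other's
  -- witnesses.
  Older : Formula H → Formula H → Set
  Older A B = rank (encode A) ≤ rank (encode B) × A ≢ B

  FreshForState : Const H → State → Set
  FreshForState c s = FreshFor c (left s) × ¬ Occurs c (right s)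

  Witnessed : State → Formula H → Set
  Witnessed s A = A ∈ Sent H → ∀ {P Q} → Axiom (witness A) A P Q → Rejects s P ⊎ Accepts s Q

  Witnessed-mono : ∀ {s t A} → s ≼ t → Witnessed s A → Witnessed t A
  Witnessed-mono s≼t w sA ax = Sum.map (Rejects-mono s≼t) (left-⊆ s≼t) (w sA ax)

  Older-fresh : ∀ {A B P Q} → Axiom (witness A) A P Q → Older A B →
                ¬ Occurs (witness B) P × ¬ Occurs (witness B) Q
  Older-fresh {A} {B} ax (A≤B , A≢B) =
    Axiom-fresh ax (witness-∉ {A = A} {B} A≤B) (A≢B ∘ sym ∘ witness-injective)

  -- Accepting `Q` is tried first; if that makes `right s` provable, `Axiom-elim` shows that `P` can
  -- be rejected. The last component keeps the witnesses of later sentences new, as they occur in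
  -- neither `P` nor `Q`.
  witness-one : ∀ s A → FreshForState (witness A) s →
                ∃[ t ] (s ≼ t × Witnessed t A × (∀ B → Older A B →
                  FreshForState (witness B) s → FreshForState (witness B) t))
  witness-one s A (c∉left , c∉right)
    with em {∃[ P ] ∃[ Q ] (A ∈ Sent H × Axiom (witness A) A P Q)}
  ... | no none = s , ≼-refl , (λ sA ax → contradiction (_ , _ , sA , ax) none) , λ _ _ → id
  ... | yes (P , Q , sA , ax) with em {left s ▸ Q ⊢ right s}
  ...   | no ¬d = accept s Q ¬d , accept-≽ s ,
    (λ _ ax′ → inj₂ (inj₂ (proj₂ (Axiom-unique ax ax′)))) ,
    λ B A<B (B∉left , B∉right) → ▸-fresh B∉left (proj₂ (Older-fresh ax A<B)) , B∉right
  ...   | yes d = t , reject-≽ s sP ,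
    (λ _ ax′ → inj₁ (subst (Rejects t) (proj₁ (Axiom-unique ax ax′)) (⊢-right∨ s sP))) ,
    λ B A<B (B∉left , B∉right) → B∉left , [ B∉right , proj₁ (Older-fresh ax A<B) ]′
    where
    sP : P ∈ Sent H
    sP = proj₁ (Axiom-Sent ax sA)

    t : State
    t = reject s P sP λ ⊢E∨P → unprovable s
      (Axiom-elim ax sA (right-Sent s) c∉left (witness-∉ {A = A} {A} ≤-refl) c∉right ⊢E∨P d)

  witness-all : ∀ {As} → AllPairs Older As → ∀ s → All (λ A → FreshForState (witness A) s) As →
                ∃[ t ] (s ≼ t × All (Witnessed t) As)
  witness-all []             s []         = s , ≼-refl , []
  witness-all (A<As ∷ sorted) s (A∉ ∷ As∉) =
    let t , s≼t , wA , fresh-after = witness-one s _ A∉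
        u , t≼u , wAs = witness-all sorted t
          (All.zipWith (λ (A<B , B∉) → fresh-after _ A<B B∉) (A<As , As∉))
    in u , ≼-trans s≼t t≼u , Witnessed-mono t≼u wA ∷ wAs

  private
    ageOrder : DecTotalOrder 0ℓ 0ℓ 0ℓ
    ageOrder = On.decTotalOrder ≤-decTotalOrder (rank ∘ encode {S})

  open Sort ageOrder using (sort; sort-↭; sort-↗)

  -- Sorting by rank yields the inequality in `Older`, and removing duplicates yields the
  -- distinctness.
  by-age : ∀ Φ → ∃[ As ] (AllPairs Older As × (∀ {A} → A List∈.∈ Φ → A List∈.∈ As))
  by-age Φ = sort Ψ ,
    AllPairs.zip (Sorted.Sorted⇒AllPairs (DecTotalOrder.totalOrder ageOrder) (sort-↗ Ψ) ,
                  Permₛ.Unique-resp-↭ (setoid _) (↭⇒↭ₛ (↭-sym (sort-↭ Ψ)))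
                    (deduplicate-! _≟ᶠ_ Φ)) ,
    λ A∈Φ → ∈-resp-↭ (↭-sym (sort-↭ Ψ)) (List∈.∈-deduplicate⁺ _≟ᶠ_ A∈Φ)
    where
    _≟ᶠ_ : (A B : Formula H) → Dec (A ≡ B)
    A ≟ᶠ B = em

    Ψ : List (Formula H)
    Ψ = deduplicate _≟ᶠ_ Φ

  Decided : State → Formula H → Set
  Decided s A = A ∈ Sent H → Accepts s A ⊎ Rejects s A

  Decided-mono : ∀ {s t A} → s ≼ t → Decided s A → Decided t A
  Decided-mono s≼t d sA = Sum.map (left-⊆ s≼t) (Rejects-mono s≼t) (d sA)

  -- Were both choices blocked, `∨E` on `right s ∨′ A` would prove `right s`.
  decide-one : ∀ s A → ∃[ t ] (s ≼ t × Decided t A)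
  decide-one s A with em {A ∈ Sent H}
  ... | no ¬sA = s , ≼-refl , λ sA → contradiction sA ¬sA
  ... | yes sA with em {left s ▸ A ⊢ right s}
  ...   | no ¬d = accept s A ¬d , accept-≽ s , λ _ → inj₁ (inj₂ refl)
  ...   | yes d =
    reject s A sA (λ ⊢E∨A → unprovable s (⊢-∨E ⊢E∨A (⊢-hyp (right-Sent s) (inj₂ refl)) d)) ,
    reject-≽ s sA , λ _ → inj₂ (⊢-right∨ s sA)

  decide-all : ∀ Φ s → ∃[ t ] (s ≼ t × All (Decided t) Φ)
  decide-all []      s = s , ≼-refl , []
  decide-all (A ∷ Φ) s =
    let t , s≼t , dA = decide-one s A
        u , t≼u , dΦ = decide-all Φ t
    in u , ≼-trans s≼t t≼u , Decided-mono t≼u dA ∷ dΦ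

  -- The prime Henkin theory

  module Canonical (Θ : Pred (Formula H) 0ℓ) (C : Formula H) (C-Sent : C ∈ Sent H) (Θ⊬C : ¬ Θ ⊢ C)
    (fresh-Θ : ∀ A → FreshFor (witness A) Θ) (fresh-C : ∀ A → ¬ Occurs (witness A) C) where

    -- Each requirement is confined to formulas in `Φ`, so that compactness applies. In `closed`
    -- this concerns the hypotheses and the conclusion of a derivation, not the formulas in between.
    record Good (Φ : List (Formula H)) (v : Subset (Formula H)) : Set where
      field
        theory    : ∀ {A} → A ∈ Sent H → A List∈.∈ Φ → A ∈ Θ → A ∈ˢ v
        goal      : C List∈.∈ Φ → ¬ C ∈ˢ v
        closed    : ∀ {Δ A} → All (λ B → B List∈.∈ Φ × B ∈ˢ v) Δ → A List∈.∈ Φ →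
                    A ∈ Sent H → Derivation Δ A → A ∈ˢ v
        prime     : ∀ {A B} → (A ∨′ B) ∈ Sent H → (A ∨′ B) List∈.∈ Φ → A List∈.∈ Φ → B List∈.∈ Φ →
                    (A ∨′ B) ∈ˢ v → A ∈ˢ v ⊎ B ∈ˢ v
        witnessed : ∀ {A P Q} → A ∈ Sent H → Axiom (witness A) A P Q →
                    A List∈.∈ Φ → P List∈.∈ Φ → Q List∈.∈ Φ → P ∈ˢ v → Q ∈ˢ v

    open Good

    Good-mono : ∀ {Φ Ψ v} → (∀ {A} → A List∈.∈ Φ → A List∈.∈ Ψ) → Good Ψ v → Good Φ v
    Good-mono sub g = record
      { theory    = λ sA A∈ → theory g sA (sub A∈)
      ; goal      = λ C∈ → goal g (sub C∈)
      ; closed    = λ Δ⊆ A∈ → closed g (All.map (λ (B∈ , B∈v) → sub B∈ , B∈v) Δ⊆) (sub A∈)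
      ; prime     = λ s A∨B∈ A∈ B∈ → prime g s (sub A∨B∈) (sub A∈) (sub B∈)
      ; witnessed = λ s ax A∈ P∈ Q∈ → witnessed g s ax (sub A∈) (sub P∈) (sub Q∈)
      }

    Good-local : ∀ {Φ v w} → (∀ {A} → A List∈.∈ Φ → v A ≡ w A) → Good Φ v → Good Φ w
    Good-local {Φ} {v} {w} eq g = record
      { theory    = λ sA A∈ A∈Θ → fwd A∈ (theory g sA A∈ A∈Θ)
      ; goal      = λ C∈ → goal g C∈ ∘ bwd C∈
      ; closed    = λ Δ⊆ A∈ sA D →
          fwd A∈ (closed g (All.map (λ (B∈ , B∈w) → B∈ , bwd B∈ B∈w) Δ⊆) A∈ sA D)
      ; prime     = λ s A∨B∈ A∈ B∈ → Sum.map (fwd A∈) (fwd B∈) ∘ prime g s A∨B∈ A∈ B∈ ∘ bwd A∨B∈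
      ; witnessed = λ s ax A∈ P∈ Q∈ → fwd Q∈ ∘ witnessed g s ax A∈ P∈ Q∈ ∘ bwd P∈
      }
      where
      fwd : ∀ {A} → A List∈.∈ Φ → A ∈ˢ v → A ∈ˢ w
      fwd A∈ = subst T (eq A∈)

      bwd : ∀ {A} → A List∈.∈ Φ → A ∈ˢ w → A ∈ˢ v
      bwd A∈ = subst T (sym (eq A∈))

    start : State
    start = record { left = Θ ; right = C ; right-Sent = C-Sent ; unprovable = Θ⊬C }

    -- The axioms come before the decisions: meeting an axiom requires its witness to be new,
    -- whereas a decision may involve any constants and preserves the axioms already met.
    Good-finite : ∀ Φ → ∃[ v ] Good Φ v
    Good-finite Φ with by-age Φ
    ... | As , sorted , Φ⊆As
      with witness-all sorted start (All.tabulate λ {A} _ → fresh-Θ A , fresh-C A)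
    ...   | s , start≼s , ws with decide-all Φ s
    ...     | t , s≼t , ds = ⟪ left t ⟫ , record
      { theory    = λ _ _ A∈Θ → fromWitness (left-⊆ s≼t (left-⊆ start≼s A∈Θ))
      ; goal      = λ _ C∈v → not-both (toWitness C∈v) (right-⊢ (≼-trans start≼s s≼t)) C-Sent
      ; closed    = λ {Δ} Δ⊆ A∈ sA D → fromWitness
          ([ id , (λ r → contradiction
                   (⊢-cut sA (Δ , All.map (λ (_ , B∈v) → toWitness B∈v) Δ⊆ , D) (⊢-mono inj₂ r))
                   (unprovable t)) ]′
          (All.lookup ds A∈ sA))
      ; prime     = λ sA∨B _ A∈ B∈ A∨B∈v → prime′ sA∨B A∈ B∈ (toWitness A∨B∈v)
      ; witnessed = λ sA ax A∈ _ _ P∈v →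
          [ (λ r → ⊥-elim (not-both (toWitness P∈v) r (proj₁ (Axiom-Sent ax sA))))
          , fromWitness ]′
          (Witnessed-mono s≼t (All.lookup ws (Φ⊆As A∈)) sA ax)
      }
      where
      not-both : ∀ {A} → Accepts t A → Rejects t A → ¬ A ∈ Sent H
      not-both acc rej sA = unprovable t (⊢-cut sA (⊢-hyp sA acc) (⊢-mono inj₂ rej))

      prime′ : ∀ {A B} → (A ∨′ B) ∈ Sent H → A List∈.∈ Φ → B List∈.∈ Φ → Accepts t (A ∨′ B) →
               A ∈ˢ ⟪ left t ⟫ ⊎ B ∈ˢ ⟪ left t ⟫
      prime′ s A∈ B∈ acc
        with All.lookup ds A∈ (λ x → s x ∘ inj₁) | All.lookup ds B∈ (λ x → s x ∘ inj₂)
      ... | inj₁ accA | _         = inj₁ (fromWitness accA)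
      ... | inj₂ _    | inj₁ accB = inj₂ (fromWitness accB)
      ... | inj₂ rejA | inj₂ rejB =
        contradiction (⊢-∨E (⊢-hyp s acc) (⊢-mono inj₂ rejA) (⊢-mono inj₂ rejB)) (unprovable t)

    saturated : ∃[ v ] (∀ Φ → Good Φ v)
    saturated = compactness Good Good-mono Good-local Good-finite

    -- The term model modulo provable identity

    module Model (v : Subset (Formula H)) (v-good : ∀ Φ → Good Φ v) where

      V : Pred (Formula H) 0ℓ
      V A = A ∈ˢ v

      V-theory : ∀ {A} → A ∈ Sent H → A ∈ Θ → A ∈ V
      V-theory {A} sA = theory (v-good (A ∷ [])) sA (here refl)

      V-goal : ¬ C ∈ V
      V-goal = goal (v-good (C ∷ [])) (here refl)

      V-closed : ∀ {Δ A} → All (_∈ V) Δ → A ∈ Sent H → Derivation Δ A → A ∈ V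
      V-closed {Δ} {A} Δ⊆V = closed (v-good (A ∷ Δ))
        (All.tabulate λ B∈Δ → there B∈Δ , All.lookup Δ⊆V B∈Δ) (here refl)

      V-prime : ∀ {A B} → (A ∨′ B) ∈ Sent H → (A ∨′ B) ∈ V → A ∈ V ⊎ B ∈ V
      V-prime {A} {B} s = prime (v-good ((A ∨′ B) ∷ A ∷ B ∷ [])) s
        (here refl) (there (here refl)) (there (there (here refl)))

      V-witnessed : ∀ {A P Q} → A ∈ Sent H → Axiom (witness A) A P Q → P ∈ V → Q ∈ V
      V-witnessed {A} {P} {Q} s ax = witnessed (v-good (A ∷ P ∷ Q ∷ [])) s ax
        (here refl) (there (here refl)) (there (there (here refl)))

      _∼_ : Const H → Const H → Set
      c ∼ d = (c ≈′ d) ∈ V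

      ≈′-Sent : ∀ c d → (c ≈′ d) ∈ Sent H
      ≈′-Sent c d x (VecAny.there (VecAny.here ()))

      ∼-refl : ∀ c → c ∼ c
      ∼-refl c = V-closed [] (≈′-Sent c c) (≈I c)

      V-[/] : ∀ A x {c d} → c ∼ d → A [ c / x ] ∈ Sent H → A [ d / x ] ∈ Sent H →
              A [ c / x ] ∈ V → A [ d / x ] ∈ V
      V-[/] A x {c} {d} c∼d sc sd p =
        V-closed (c∼d ∷ p ∷ []) sd (≈E A x (hyp (≈′-Sent c d)) (hyp sc))

      ∼-sym : ∀ {c d} → c ∼ d → d ∼ c
      ∼-sym {c} {d} c∼d =
        V-[/] (atom (≈ S) (var 0 ∷ con c ∷ [])) 0 c∼d (≈′-Sent c c) (≈′-Sent d c) (∼-refl c)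

      ∼-trans : ∀ {b c d} → b ∼ c → c ∼ d → b ∼ d
      ∼-trans {b} {c} {d} b∼c c∼d =
        V-[/] (atom (≈ S) (con b ∷ var 0 ∷ [])) 0 c∼d (≈′-Sent b c) (≈′-Sent b d) b∼c

      default : Const H
      default = proj₁ (fresh {H} [])

      -- The choice depends only on the Boolean predicate. Equivalent constants have equal
      -- predicates by extensionality, hence the same representative.
      pick : Subset (Const H) → Const H
      pick X with em {∃[ c ] c ∈ˢ X}
      ... | yes (c , _) = c
      ... | no  _       = default

      pick-∈ : ∀ X {c} → c ∈ˢ X → pick X ∈ˢ X
      pick-∈ X {c} c∈X with em {∃[ c ] c ∈ˢ X}
      ... | yes (_ , d∈X) = d∈X
      ... | no  none      = contradiction (c , c∈X) none

      rep : Const H → Const H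
      rep c = pick λ d → v (c ≈′ d)

      ∼-rep : ∀ c → c ∼ rep c
      ∼-rep c = pick-∈ (λ d → v (c ≈′ d)) (∼-refl c)

      rep-cong : ∀ {c d} → c ∼ d → rep c ≡ rep d
      rep-cong c∼d = cong pick (⊆ˢ-antisym (∼-trans (∼-sym c∼d)) (∼-trans c∼d))

      -- The quotient of the constants by `∼`, realised as the set of chosen representatives.
      D : Set
      D = ∃[ c ] rep c ≡ c

      class : Const H → D
      class c = rep c , sym (rep-cong (∼-rep c))

      D-≡ : ∀ {a b : D} → proj₁ a ≡ proj₁ b → a ≡ b
      D-≡ {c , p} {_ , q} refl = cong (c ,_) (≡-irrelevant p q)

      𝔄 : Structure S
      𝔄 = record
        { Domain   = D
        ; nonempty = class default
        ; ⟦_⟧      = λ c → class (inj₁ c)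
        ; _⁺       = λ P ds → atom P (Vec.map (con ∘ proj₁) ds) ∈ V
        ; _⁻       = λ P ds → (¬′ atom P (Vec.map (con ∘ proj₁) ds)) ∈ V
        ; ≈⁺       = λ {a} {b} → mk⇔
            (λ a∼b → D-≡ (trans (sym (proj₂ a)) (trans (rep-cong a∼b) (proj₂ b))))
            λ { refl → ∼-refl (proj₁ a) }
        }

      e : Term H → D
      e (var x) = class default
      e (con c) = class c

      signed-Sent : ∀ b {A : Formula H} → A ∈ Sent H → signed b A ∈ Sent H
      signed-Sent true  s = s
      signed-Sent false s = s

      signed-[/] : ∀ b (A : Formula H) {c x} → signed b A [ c / x ] ≡ signed b (A [ c / x ])
      signed-[/] true  A = refl
      signed-[/] false A = refl

      -- Positions are rewritten one at a time from the left. The context `k` holds those already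
      -- rewritten, and `nat` expresses that it contributes no variable.
      replace-constants : ∀ b {m n} (P : Letter S n) (k : Vec (Term H) m → Vec (Term H) n) →
        (∀ ts c x → Vec.map (_[ c / x ]ᵗ) (k ts) ≡ k (Vec.map (_[ c / x ]ᵗ) ts)) →
        (∀ cs → atom P (k (Vec.map con cs)) ∈ Sent H) →
        {f g : Const H → Const H} → (∀ c → f c ∼ g c) → ∀ cs →
        signed b (atom P (k (Vec.map con (Vec.map f cs)))) ∈ V →
        signed b (atom P (k (Vec.map con (Vec.map g cs)))) ∈ V
      replace-constants b P k nat sent f∼g [] p = p
      replace-constants b P k nat sent {f} {g} f∼g (c ∷ cs) p =
        replace-constants b P (k ∘ (con (g c) ∷_)) (λ ts → nat (con (g c) ∷ ts))
          (sent ∘ (g c ∷_)) f∼g cs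
          (subst (_∈ V) (inst (g c))
            (V-[/] A 0 (f∼g c) (inst-Sent (f c)) (inst-Sent (g c))
              (subst (_∈ V) (sym (inst (f c))) p)))
        where
        us : Vec (Const H) _
        us = Vec.map f cs

        A : Formula H
        -- The variable 0 marks the position to be rewritten; all other terms are constants.
        A = signed b (atom P (k (var 0 ∷ Vec.map con us)))

        inst : ∀ d → A [ d / 0 ] ≡ signed b (atom P (k (con d ∷ Vec.map con us)))
        inst d = trans (signed-[/] b _) (cong (signed b ∘ atom P)
          (trans (nat _ d 0) (cong (λ ts → k (con d ∷ ts)) (sym (Vec.map-∘ _ con us)))))

        inst-Sent : ∀ d → A [ d / 0 ] ∈ Sent H
        inst-Sent d = subst (_∈ Sent H) (sym (inst d)) (signed-Sent b (sent (d ∷ us)))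

      constants-Sent : ∀ {n} (P : Letter S n) (cs : Vec (Const H) n) →
                       atom P (Vec.map con cs) ∈ Sent H
      constants-Sent P cs x p with ∈-map⁻ con cs p
      ... | _ , _ , ()

      relations-signed : ∀ b {n} (P : Letter S n) ds →
                         relations 𝔄 b P ds ≡ (signed b (atom P (Vec.map (con ∘ proj₁) ds)) ∈ V)
      relations-signed true  P ds = refl
      relations-signed false P ds = refl

      V-atom : ∀ b {n} (P : Letter S n) ts → atom P ts ∈ Sent H →
               signed b (atom P ts) ∈ V ⇔ Sat (relations 𝔄) b e (atom P ts)
      V-atom b P ts s with closed-terms ts s
      ... | cs , refl = mk⇔
        (λ p → subst id (sym sat≡)
          (replace-constants b P id (λ _ _ _ → refl) (constants-Sent P) ∼-rep cs
            (subst (λ us → signed b (atom P (Vec.map con us)) ∈ V) (sym (Vec.map-id cs)) p)))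
        (λ p → subst (λ us → signed b (atom P (Vec.map con us)) ∈ V) (Vec.map-id cs)
          (replace-constants b P id (λ _ _ _ → refl) (constants-Sent P) (∼-sym ∘ ∼-rep) cs
            (subst id sat≡ p)))
        where
        sat≡ : (Vec.map e (Vec.map con cs) ∈ relations 𝔄 b P) ≡
               (signed b (atom P (Vec.map con (Vec.map rep cs))) ∈ V)
        sat≡ = trans (relations-signed b P _) (cong (λ us → signed b (atom P us) ∈ V)
          (trans (cong (Vec.map (con ∘ proj₁)) (sym (Vec.map-∘ e con cs)))
            (trans (sym (Vec.map-∘ (con ∘ proj₁) (e ∘ con) cs)) (Vec.map-∘ con rep cs))))

      V-rule : ∀ {A B} → A ∈ Sent H → B ∈ Sent H → Derivation (A ∷ []) B → A ∈ V → B ∈ V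
      V-rule sA sB d A∈V = V-closed (A∈V ∷ []) sB d

      e-class : ∀ d → e (con (proj₁ d)) ≡ d
      e-class d = D-≡ (proj₂ d)

      V-Valuation : Valuation (relations 𝔄) e V
      V-Valuation = record
        { nm     = proj₁
        ; e-nm   = e-class
        ; V-atom = V-atom
        ; V-∧    = λ s → let sA = λ x → s x ∘ inj₁ ; sB = λ x → s x ∘ inj₂ in mk⇔
            (λ p → V-rule s sA (∧E₁ (hyp s)) p , V-rule s sB (∧E₂ (hyp s)) p)
            (λ (p , q) → V-closed (p ∷ q ∷ []) s (∧I (hyp sA) (hyp sB)))
        ; V-¬∧   = λ s → let sA = λ x → s x ∘ inj₁ ; sB = λ x → s x ∘ inj₂ in mk⇔
            -- Primeness concerns disjunctions, so `¬′ (A ∧′ B)` is first turned into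
            -- `¬′ A ∨′ ¬′ B`.
            (λ p → V-prime s (V-rule s s
              (¬∧E (hyp s) (∨I₁ sB (hyp sA)) (drop done) (∨I₂ sA (hyp sB)) (drop done)) p))
            [ V-rule sA s (¬∧I₁ sB (hyp sA)) , V-rule sB s (¬∧I₂ sA (hyp sB)) ]′
        ; V-∨    = λ s → let sA = λ x → s x ∘ inj₁ ; sB = λ x → s x ∘ inj₂ in mk⇔
            (V-prime s)
            [ V-rule sA s (∨I₁ sB (hyp sA)) , V-rule sB s (∨I₂ sA (hyp sB)) ]′
        ; V-¬∨   = λ s → let sA = λ x → s x ∘ inj₁ ; sB = λ x → s x ∘ inj₂ in mk⇔
            (λ p → V-rule s sA (¬∨E₁ (hyp s)) p , V-rule s sB (¬∨E₂ (hyp s)) p)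
            (λ (p , q) → V-closed (p ∷ q ∷ []) s (¬∨I (hyp sA) (hyp sB)))
        ; V-¬¬   = λ s → mk⇔ (V-rule s s (DNE (hyp s))) (V-rule s s (DNI (hyp s)))
        ; V-∀    = λ {x} {A} {p} s → mk⇔
            (λ h d → V-rule s (inst-Sent A s _) (∀E (proj₁ d) (hyp s)) h)
            -- The hypothesis is used at the class of the witness constant, and the representative
            -- is then exchanged for the witness itself.
            (λ h → V-witnessed s ∀-axiom
              (V-[/] A x (∼-sym (∼-rep _)) (inst-Sent A s _) (inst-Sent A s _) (h (class _))))
        ; V-¬∀   = λ {x} {A} {p} s → mk⇔
            (λ h → class _ , V-[/] (¬′ A) x (∼-rep _) (inst-Sent A s _) (inst-Sent A s _)
              (V-witnessed s ¬∀-axiom h))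
            (λ (d , h) → V-rule (inst-Sent A s _) s (¬∀I p (hyp (inst-Sent A s _))) h)
        ; V-∃    = λ {x} {A} {p} s → mk⇔
            (λ h → class _ , V-[/] A x (∼-rep _) (inst-Sent A s _) (inst-Sent A s _)
              (V-witnessed s ∃-axiom h))
            (λ (d , h) → V-rule (inst-Sent A s _) s (∃I p (hyp (inst-Sent A s _))) h)
        ; V-¬∃   = λ {x} {A} {p} s → mk⇔
            (λ h d → V-rule s (inst-Sent A s _) (¬∃E (proj₁ d) (hyp s)) h)
            (λ h → V-witnessed s ¬∃-axiom
              (V-[/] (¬′ A) x (∼-sym (∼-rep _)) (inst-Sent A s _) (inst-Sent A s _) (h (class _))))
        }
        where
        inst-Sent : ∀ {x} A → (∀ y → ¬ (y ≢ x × Free y A)) → ∀ c → A [ c / x ] ∈ Sent H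
        inst-Sent A s = Sent-[/] A λ y y≢x f → s y (y≢x , f)

      -- Satisfaction in `𝔄` links two truth lemmas, one over the diagram signature and one over the
      -- Henkin signature.
      v-lift⇔V : ∀ A → A ∈ Sent S → v⟨ 𝔄 ⟩ lift 𝔄 A ≡1 ⇔ rename inj₁ A ∈ V
      v-lift⇔V A s =
        ⇔-sym (Truth.truth V-Valuation (rename inj₁ A) (Sent-rename inj₁ A s)) ⇔-∘
        (⇔-sym (Sat-rename true A λ { (var _) → refl ; (con _) → refl }) ⇔-∘ v-lift⇔Sat 𝔄 A s)

  -- The countermodel and completeness

  complete : ∀ (Γ : Pred (Formula S) 0ℓ) A → (Γ ∪ ｛ A ｝) ⊆ Sent S → Γ ⊨ A → Γ ⊢ A
  complete Γ A sent Γ⊨A = decidable-stable em Countermodel.absurd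
    where
    sA : A ∈ Sent S
    sA = sent (inj₂ refl)

    Θ : Pred (Formula H) 0ℓ
    Θ B′ = ∃[ B ] (B ∈ Γ × B′ ≡ rename inj₁ B)

    fresh-image : ∀ B A → ¬ Occurs (witness B) (rename {S} inj₁ A)
    fresh-image B A o with Occurs-rename⁻ inj₁ A o
    ... | _ , _ , ()

    fresh-Θ : ∀ B → FreshFor (witness B) Θ
    fresh-Θ B _ (A , _ , refl) = fresh-image B A

    -- All witness constants go to one constant of `S`; the renaming of derivations supplies new
    -- eigenconstants where this identification would violate a side condition.
    retract : Const H → Const S
    retract = [ id , const (proj₁ (fresh {S} [])) ]′

    pull-back : Θ ⊢ rename inj₁ A → Γ ⊢ A
    pull-back (Δ , Δ⊆Θ , D) =
      map (rename retract) Δ ,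
      All.map⁺ (All.map (λ { (B , B∈Γ , refl) → subst (_∈ Γ) (sym (back B)) B∈Γ }) Δ⊆Θ) ,
      subst (Derivation _) (back A) (rename-Derivation D retract)
      where
      back : ∀ B → rename retract (rename inj₁ B) ≡ B
      back = rename-inverse inj₁ retract λ _ → refl

    module Countermodel (Γ⊬A : ¬ Γ ⊢ A) where
      open Canonical Θ (rename inj₁ A) (Sent-rename inj₁ A sA) (Γ⊬A ∘ pull-back) fresh-Θ
        (λ B → fresh-image B A)
      open Model (proj₁ saturated) (proj₂ saturated)

      absurd : ⊥
      absurd = V-goal (to (v-lift⇔V A sA) (Γ⊨A 𝔄 λ {B} B∈Γ →
        from (v-lift⇔V B (sent (inj₁ B∈Γ)))
          (V-theory (Sent-rename inj₁ B (sent (inj₁ B∈Γ))) (B , B∈Γ , refl))))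

mainTheorem3 : ExcludedMiddle (lsuc 0ℓ) → Extensionality (lsuc 0ℓ) (lsuc 0ℓ) →
    (S : Signature) (Γ : Pred (Formula S) 0ℓ) (A : Formula S) →
    (Γ ∪ ｛ A ｝) ⊆ Sent S →
    (Γ ⊢ A) ⇔ (Γ ⊨ A)
mainTheorem3 em₁ ext₁ S Γ A sent = mk⇔ soundness (Completeness.complete em ext Γ A sent)
  where
  em : ExcludedMiddle 0ℓ
  em = map′ Level.lower Level.lift em₁

  ext : Extensionality 0ℓ 0ℓ
  ext = lower-extensionality (lsuc 0ℓ) (lsuc 0ℓ) ext₁

  soundness : Γ ⊢ A → Γ ⊨ A
  soundness (Δ , Δ⊆Γ , D) 𝔄 Γ-true = from (v-lift⇔Sat 𝔄 A (sent (inj₂ refl)))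
    (Soundness.sound em (relations 𝔄) (Structure.≈⁺ 𝔄) D (eval 𝔄)
      (All.map (λ {B} B∈Γ → to (v-lift⇔Sat 𝔄 B (sent (inj₁ B∈Γ))) (Γ-true B∈Γ)) Δ⊆Γ))
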